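{- Let $CP_3(n)$ be defined by $\sum_{n\ge 0} CP_3(n)q^n = \dfrac{f_3^6f_6^6}{f_1^2f_2^2}$. Then for all integers $n\ge 0$, \[ CP_3(24n+7)\equiv 0\pmod{16},\quad CP_3(24n+13)\equiv 0\pmod{4},\quad CP_3(24n+19)\equiv 0\pmod{8}. \]
   Context: For $|q|<1$ and integer $m\ge 1$, $f_m := (q^m;q^m)_\infty=\prod_{n\ge1}(1-q^{mn})$. $CP_3(n)$ is the number of $3$-core cubic bipartitions of $n$, defined by the generating function $\sum_{n\ge0}CP_3(n)q^n = \frac{f_3^6f_6^6}{f_1^2f_2^2}$. -}

module Defs where

open import Data.Nat as ℕ using (ℕ; zero; suc)
open import Data.Integer using (ℤ; +_; _+_; _*_; -_; _-_)
open import Relation.Nullary using (yes; no)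

Series : Set
Series = ℕ → ℤ

sumTo : ℕ → (ℕ → ℤ) → ℤ
sumTo zero    g = + 0
sumTo (suc n) g = sumTo n g + g n

_⊛_ : Series → Series → Series
(a ⊛ b) n = sumTo (suc n) (λ i → a i * b (n ℕ.∸ i))

one : Series
one zero    = + 1
one (suc _) = + 0

_^ₛ_ : Series → ℕ → Series
a ^ₛ zero    = one
a ^ₛ (suc k) = a ⊛ (a ^ₛ k)

-- The polynomial 1 - q^d  (d ≥ 1 in use)
oneMinusQ^ : ℕ → Series
oneMinusQ^ d n with n ℕ.≟ 0 | n ℕ.≟ d
... | yes _ | _ = + 1
... | no _  | yes _ = - (+ 1)
... | no _  | no _ = + 0

partialEta : ℕ → ℕ → Series
partialEta m zero    = one
partialEta m (suc N) = oneMinusQ^ (m ℕ.* suc N) ⊛ partialEta m N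

-- f_m = (q^m;q^m)_∞ = Π_{k≥1} (1 - q^{m k}).  For m ≥ 1, the coefficient of
-- q^n only depends on the factors with m k ≤ n, hence on k ≤ n, so it equals
-- the coefficient of q^n in the partial product up to k = n.
f : ℕ → Series
f m n = partialEta m n n

denominator : Series
denominator = (f 1 ^ₛ 2) ⊛ (f 2 ^ₛ 2)

numerator : Series
numerator = (f 3 ^ₛ 6) ⊛ (f 6 ^ₛ 6)

-- CP₃ is the (unique, since the denominator has constant term 1) series with
--   CP₃ · f_1^2 f_2^2 = f_3^6 f_6^6.
IsCP3 : Series → Set
IsCP3 c = ∀ n → (c ⊛ denominator) n ≡ numerator n
  where open import Relation.Binary.PropositionalEquality using (_≡_)

-- Explicit definition of 1/a for a series a with a 0 = 1:
--   b 0 = 1,  b n = - Σ_{k=1}^{n} a k · b (n - k).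
-- invPrefix a n = the coefficients b 0, …, b n, as a function (values beyond n irrelevant).
invPrefix : Series → ℕ → Series
invPrefix a zero    = one
invPrefix a (suc n) i with i ℕ.≟ suc n
... | no _  = invPrefix a n i
... | yes _ = - sumTo (suc n) (λ j → a (suc j) * invPrefix a n (n ℕ.∸ j))

inv : Series → Series
inv a n = invPrefix a n n

CP3 : Series
CP3 = numerator ⊛ inv denominator

{-# OPTIONS --safe #-}
module Submission where

open import Defs
open import Data.Nat using (ℕ; _+_; _*_)
open import Data.Integer using (ℤ; +_)
open import Data.Integer.Divisibility using (_∣_)
open import Data.Product using (_×_)
open import Data.Nat as ℕ using (zero; suc)
import Data.Nat.Properties as ℕ
open import Data.Nat.Solver using () renaming (module +-*-Solver to ℕ-Solver)
open import Data.Integer as ℤ using (-[1+_])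
import Data.Integer.Properties as ℤ
open import Data.Integer.Solver using (module +-*-Solver)
open import Data.Integer.Divisibility.Signed as Signed using (divides)
  renaming (_∣_ to _∣ₛ_; _∣?_ to _∣ₛ?_)
open import Algebra.Bundles using (CommutativeRing)
open import Algebra.Structures using (IsCommutativeRing)
open import Algebra.Solver.Ring.AlmostCommutativeRing
  using (AlmostCommutativeRing; fromCommutativeRing; _-Raw-AlmostCommutative⟶_)
import Algebra.Solver.Ring
open import Data.Maybe.Base using (Maybe; just; nothing)
open import Data.Product using (_,_; Σ; proj₁; proj₂)
open import Data.Sum using (inj₁; inj₂)
open import Relation.Nullary using (yes; no; ¬_; contradiction; Dec)
open import Relation.Nullary.Decidable using (from-yes; from-no)
open import Relation.Binary.Bundles using (Setoid)
open import Relation.Binary.PropositionalEquality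
import Relation.Binary.Reasoning.Setoid as SetoidReasoning

-- Write f_k for (q^k;q^k)_∞, φ(z) = Σ_{k∈ℤ} z^{k²} and ψ(x) = Σ_{k∈ℤ} x^{k(2k+1)}.  Gauss's
-- products φ(-x) f₂ = f₁² and ψ(x) f₁ = f₂² (in base x) turn the definition of CP₃ into
--   CP₃ f₂⁷ = φ(-q³)⁴ φ(q) φ(q³) · f₆⁵ f₄² f₁₂²,
-- where everything but φ(-q³)⁴ φ(q) φ(q³) is a series in q².  Inserting φ(z) = φ(z⁴) + 2zψ(z⁸)
-- and the lattice identity
--   φ(q⁴) q³ψ(q²⁴) + qψ(q⁸) φ(q¹²) = qψ(q²)ψ(q⁶)
-- the odd part of CP₃ is, modulo 16,
--   2q f₁₂⁴ f₆⁴ + 8q³ψ(q²⁴) f₆⁹/f₂³.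
-- By f_k² ≡ f_{2k} mod 2, and the lattice identity once more to dissect f₆³/f₂ mod 2, this is
--   2q M₁ + 8(q³M₃ + q⁵M₅ + q⁹M₉)
-- with M₁ a series in q¹² (and M₁ ≡ f₂₄³ mod 2) and M₃, M₅, M₉ series in q⁸.

open ℕ-Solver using ()
  renaming (solve to solveℕ; _:+_ to _⊹_; _:*_ to _×′_; _:=_ to _≐_; con to conℕ)
open +-*-Solver using ()
  renaming (solve to solveℤ; _:+_ to _⊞_; _:*_ to _⊠_; _:=_ to _≗′_; con to conℤ; :-_ to ⊟_)

-- The ring of integer power series

-- The three moduli come from comparing exponents in the final form. The term 2q M₁ lives on
-- exponents 1 mod 12, and the terms with M₃, M₅, M₉ live on 3, 5 and 1 mod 8. The class 7 mod 24
-- avoids all of them and keeps the full modulus 16. The class 19 avoids 2q M₁ but is 3 mod 8, so it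
-- keeps only 8. The class 13 is 1 mod 12, but modulo 4 the term 2q M₁ is 2q f₂₄³, which lives on 1
-- mod 24; this leaves 4. The modulus 16 is reachable because the odd part already carries a factor
-- 2: its main term is needed only modulo 8, and the terms with coefficient 8 only modulo 2. The
-- formal obstacle is that infinite products and bilateral sums exist only as limits. The product
-- formulas therefore come from identities between finite products, passed to the q-adic limit, and
-- quotients are handled by multiplying through and cancelling a series with constant term 1.

tail : Series → Series
tail a n = a (suc n)

sumTo-cong : ∀ n {g h : ℕ → ℤ} → (∀ i → i ℕ.< n → g i ≡ h i) → sumTo n g ≡ sumTo n h
sumTo-cong zero    eq = refl
sumTo-cong (suc n) eq =
  cong₂ ℤ._+_ (sumTo-cong n λ i i<n → eq i (ℕ.m≤n⇒m≤1+n i<n)) (eq n ℕ.≤-refl)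

sumTo-zero : ∀ n {g : ℕ → ℤ} → (∀ i → i ℕ.< n → g i ≡ + 0) → sumTo n g ≡ + 0
sumTo-zero zero    eq = refl
sumTo-zero (suc n) eq =
  cong₂ ℤ._+_ (sumTo-zero n λ i i<n → eq i (ℕ.m≤n⇒m≤1+n i<n)) (eq n ℕ.≤-refl)

sumTo-head : ∀ n (g : ℕ → ℤ) → sumTo (suc n) g ≡ g 0 ℤ.+ sumTo n (λ i → g (suc i))
sumTo-head zero    g = ℤ.+-comm (+ 0) (g 0)
sumTo-head (suc n) g =
  trans (cong (ℤ._+ g (suc n)) (sumTo-head n g)) (ℤ.+-assoc (g 0) _ _)

sumTo-+ : ∀ n (g h : ℕ → ℤ) → sumTo n (λ i → g i ℤ.+ h i) ≡ sumTo n g ℤ.+ sumTo n h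
sumTo-+ zero    g h = refl
sumTo-+ (suc n) g h = trans (cong (ℤ._+ (g n ℤ.+ h n)) (sumTo-+ n g h))
  (solve 4 (λ x y u v → (x :+ y) :+ (u :+ v) := (x :+ u) :+ (y :+ v)) refl
    (sumTo n g) (sumTo n h) (g n) (h n))
  where open +-*-Solver

sumTo-* : ∀ n k (g : ℕ → ℤ) → sumTo n (λ i → k ℤ.* g i) ≡ k ℤ.* sumTo n g
sumTo-* zero    k g = sym (ℤ.*-zeroʳ k)
sumTo-* (suc n) k g =
  trans (cong (ℤ._+ k ℤ.* g n) (sumTo-* n k g)) (sym (ℤ.*-distribˡ-+ k _ _))

⊛-zero : ∀ a b → (a ⊛ b) 0 ≡ a 0 ℤ.* b 0
⊛-zero a b = ℤ.+-identityˡ _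

⊛-suc : ∀ a b n → (a ⊛ b) (suc n) ≡ a 0 ℤ.* b (suc n) ℤ.+ (tail a ⊛ b) n
⊛-suc a b n = sumTo-head (suc n) (λ i → a i ℤ.* b (suc n ℕ.∸ i))

⊛-cong≤ : ∀ n {a a′ b b′ : Series} → (∀ i → i ℕ.≤ n → a i ≡ a′ i) →
          (∀ i → i ℕ.≤ n → b i ≡ b′ i) → (a ⊛ b) n ≡ (a′ ⊛ b′) n
⊛-cong≤ n p r = sumTo-cong (suc n) λ i i<1+n →
  cong₂ ℤ._*_ (p i (ℕ.≤-pred i<1+n)) (r (n ℕ.∸ i) (ℕ.m∸n≤m n i))

⊛-distribʳ : ∀ a b c n → ((λ i → a i ℤ.+ b i) ⊛ c) n ≡ (a ⊛ c) n ℤ.+ (b ⊛ c) n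
⊛-distribʳ a b c n =
  trans (sumTo-cong (suc n) λ i _ → ℤ.*-distribʳ-+ (c (n ℕ.∸ i)) (a i) (b i))
        (sumTo-+ (suc n) _ _)

⊛-scaleˡ : ∀ k a b n → ((λ i → k ℤ.* a i) ⊛ b) n ≡ k ℤ.* (a ⊛ b) n
⊛-scaleˡ k a b n =
  trans (sumTo-cong (suc n) λ i _ → ℤ.*-assoc k (a i) (b (n ℕ.∸ i))) (sumTo-* (suc n) k _)

-- The mirror image of `⊛-suc`, peeling the other factor. The two recursions together give
-- commutativity by induction, with no reversal of the summation index.
⊛-suc′ : ∀ a b n → (a ⊛ b) (suc n) ≡ a (suc n) ℤ.* b 0 ℤ.+ (a ⊛ tail b) n
⊛-suc′ a b zero = trans (⊛-suc a b 0) (trans (cong (λ t → a 0 ℤ.* b 1 ℤ.+ t) (⊛-zero (tail a) b))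
  (trans (ℤ.+-comm (a 0 ℤ.* b 1) (a 1 ℤ.* b 0))
    (cong (λ t → a 1 ℤ.* b 0 ℤ.+ t) (sym (⊛-zero a (tail b))))))
⊛-suc′ a b (suc n) = begin
  (a ⊛ b) (suc (suc n))                                        ≡⟨ ⊛-suc a b (suc n) ⟩
  x ℤ.+ (tail a ⊛ b) (suc n)                                   ≡⟨ cong (λ t → x ℤ.+ t) (⊛-suc′ (tail a) b n) ⟩
  x ℤ.+ (y ℤ.+ z)                                              ≡⟨ solve 3 (λ x y z → x :+ (y :+ z) := y :+ (x :+ z)) refl x y z ⟩
  y ℤ.+ (x ℤ.+ z)                                              ≡⟨ cong (λ t → y ℤ.+ t) (sym (⊛-suc a (tail b) n)) ⟩
  y ℤ.+ (a ⊛ tail b) (suc n)                                   ∎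
  where
  open ≡-Reasoning
  open +-*-Solver
  x = a 0 ℤ.* b (suc (suc n))
  y = a (suc (suc n)) ℤ.* b 0
  z = (tail a ⊛ tail b) n

⊛-comm : ∀ a b n → (a ⊛ b) n ≡ (b ⊛ a) n
⊛-comm a b zero    = trans (⊛-zero a b) (trans (ℤ.*-comm (a 0) (b 0)) (sym (⊛-zero b a)))
⊛-comm a b (suc n) = trans (⊛-suc a b n)
  (trans (cong₂ ℤ._+_ (ℤ.*-comm (a 0) (b (suc n))) (⊛-comm (tail a) b n)) (sym (⊛-suc′ b a n)))

-- `tail` acts like a derivative with the product rule tail (a b) = a₀ (tail b) + (tail a) b, so
-- associativity follows by induction on the coefficient, without double sums.
⊛-assoc : ∀ a b c n → ((a ⊛ b) ⊛ c) n ≡ (a ⊛ (b ⊛ c)) n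
⊛-assoc a b c zero = begin
  ((a ⊛ b) ⊛ c) 0              ≡⟨ ⊛-zero (a ⊛ b) c ⟩
  (a ⊛ b) 0 ℤ.* c 0            ≡⟨ cong (ℤ._* c 0) (⊛-zero a b) ⟩
  (a 0 ℤ.* b 0) ℤ.* c 0        ≡⟨ ℤ.*-assoc (a 0) (b 0) (c 0) ⟩
  a 0 ℤ.* (b 0 ℤ.* c 0)        ≡⟨ cong (a 0 ℤ.*_) (sym (⊛-zero b c)) ⟩
  a 0 ℤ.* (b ⊛ c) 0            ≡⟨ sym (⊛-zero a (b ⊛ c)) ⟩
  (a ⊛ (b ⊛ c)) 0              ∎
  where open ≡-Reasoning
⊛-assoc a b c (suc n) = begin
  ((a ⊛ b) ⊛ c) (suc n)                                       ≡⟨ ⊛-suc (a ⊛ b) c n ⟩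
  (a ⊛ b) 0 ℤ.* c₁ ℤ.+ (tail (a ⊛ b) ⊛ c) n
    ≡⟨ cong₂ ℤ._+_ (cong (ℤ._* c₁) (⊛-zero a b))
         (⊛-cong≤ n {b = c} {b′ = c} (λ i _ → ⊛-suc a b i) (λ _ _ → refl)) ⟩
  (a 0 ℤ.* b 0) ℤ.* c₁ ℤ.+ ((λ i → a 0 ℤ.* tail b i ℤ.+ (tail a ⊛ b) i) ⊛ c) n
    ≡⟨ cong (λ t → (a 0 ℤ.* b 0) ℤ.* c₁ ℤ.+ t) (⊛-distribʳ (λ i → a 0 ℤ.* tail b i) (tail a ⊛ b) c n) ⟩
  (a 0 ℤ.* b 0) ℤ.* c₁ ℤ.+ (((λ i → a 0 ℤ.* tail b i) ⊛ c) n ℤ.+ ((tail a ⊛ b) ⊛ c) n)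
    ≡⟨ cong (λ t → (a 0 ℤ.* b 0) ℤ.* c₁ ℤ.+ t)
         (cong₂ ℤ._+_ (⊛-scaleˡ (a 0) (tail b) c n) (⊛-assoc (tail a) b c n)) ⟩
  (a 0 ℤ.* b 0) ℤ.* c₁ ℤ.+ (a 0 ℤ.* u ℤ.+ v)
    ≡⟨ solve 5 (λ a b c u v → (a :* b) :* c :+ (a :* u :+ v) := a :* (b :* c :+ u) :+ v) refl
         (a 0) (b 0) c₁ u v ⟩
  a 0 ℤ.* (b 0 ℤ.* c₁ ℤ.+ u) ℤ.+ v                            ≡⟨ cong (λ t → a 0 ℤ.* t ℤ.+ v) (sym (⊛-suc b c n)) ⟩
  a 0 ℤ.* (b ⊛ c) (suc n) ℤ.+ v                               ≡⟨ sym (⊛-suc a (b ⊛ c) n) ⟩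
  (a ⊛ (b ⊛ c)) (suc n)                                       ∎
  where
  open ≡-Reasoning
  open +-*-Solver
  c₁ = c (suc n)
  u = (tail b ⊛ c) n
  v = (tail a ⊛ (b ⊛ c)) n

-- Opaque so that unification can read off the factors of a product instead of unfolding it.
opaque
  infixl 7 _·_
  infixl 6 _+ˢ_
  infix  8 -ˢ_

  _·_ : Series → Series → Series
  _·_ = _⊛_

  _+ˢ_ : Series → Series → Series
  (a +ˢ b) n = a n ℤ.+ b n

  -ˢ_ : Series → Series
  (-ˢ a) n = ℤ.- a n

  const : ℤ → Series
  const k zero    = k
  const k (suc _) = + 0

infix 4 _≋_
-- Pointwise equality is wrapped in a record so that both series can be inferred from the type of a
-- proof.
record _≋_ (a b : Series) : Set where
  constructor mk≋
  field at : ∀ n → a n ≡ b n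
open _≋_

≋-refl : ∀ {a} → a ≋ a
≋-refl = mk≋ λ _ → refl

≋-sym : ∀ {a b} → a ≋ b → b ≋ a
≋-sym p = mk≋ λ n → sym (at p n)

≋-trans : ∀ {a b c} → a ≋ b → b ≋ c → a ≋ c
≋-trans p r = mk≋ λ n → trans (at p n) (at r n)

opaque
  unfolding _·_

  ·-⊛ : ∀ a b → a · b ≋ a ⊛ b
  ·-⊛ a b = ≋-refl

  +ˢ-at : ∀ a b n → (a +ˢ b) n ≡ a n ℤ.+ b n
  +ˢ-at a b n = refl

  -ˢ-at : ∀ a n → (-ˢ a) n ≡ ℤ.- a n
  -ˢ-at a n = refl

  const-⊛ : ∀ k a n → (const k ⊛ a) n ≡ k ℤ.* a n
  const-⊛ k a zero    = ⊛-zero (const k) a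
  const-⊛ k a (suc n) = trans (⊛-suc (const k) a n)
    (trans (cong (λ t → k ℤ.* a (suc n) ℤ.+ t) (sumTo-zero (suc n) λ i _ → refl)) (ℤ.+-identityʳ _))

  const-· : ∀ k a n → (const k · a) n ≡ k ℤ.* a n
  const-· = const-⊛

  const-zero : ∀ k → const k 0 ≡ k
  const-zero k = refl

  const-suc : ∀ k n → const k (suc n) ≡ + 0
  const-suc k n = refl

  const-0 : ∀ n → const (+ 0) n ≡ + 0
  const-0 zero    = refl
  const-0 (suc n) = refl

  one-const : one ≋ const (+ 1)
  one-const = mk≋ λ { zero → refl ; (suc n) → refl }

  const-+ : ∀ j k → const (j ℤ.+ k) ≋ const j +ˢ const k
  const-+ j k = mk≋ λ { zero → refl ; (suc n) → refl }

  const-* : ∀ j k → const (j ℤ.* k) ≋ const j · const k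
  const-* j k = mk≋ λ
    { zero    → sym (const-⊛ j (const k) 0)
    ; (suc n) → sym (trans (const-⊛ j (const k) (suc n)) (ℤ.*-zeroʳ j)) }

  const-neg : ∀ k → const (ℤ.- k) ≋ -ˢ const k
  const-neg k = mk≋ λ { zero → refl ; (suc n) → refl }

  seriesIsCommutativeRing :
    IsCommutativeRing _≋_ _+ˢ_ _·_ -ˢ_ (const (+ 0)) (const (+ 1))
  seriesIsCommutativeRing = record
    { isRing = record
      { +-isAbelianGroup = record
        { isGroup = record
          { isMonoid = record
            { isSemigroup = record
              { isMagma = record
                { isEquivalence = record { refl = ≋-refl ; sym = ≋-sym ; trans = ≋-trans }
                ; ∙-cong = λ p r → mk≋ λ n → cong₂ ℤ._+_ (at p n) (at r n) }
              ; assoc = λ a b c → mk≋ λ n → ℤ.+-assoc (a n) (b n) (c n) }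
            ; identity = (λ a → mk≋ λ { zero → ℤ.+-identityˡ _ ; (suc n) → ℤ.+-identityˡ _ })
                       , (λ a → mk≋ λ { zero → ℤ.+-identityʳ _ ; (suc n) → ℤ.+-identityʳ _ }) }
          ; inverse = (λ a → mk≋ λ { zero → ℤ.+-inverseˡ (a 0) ; (suc n) → ℤ.+-inverseˡ (a (suc n)) })
                    , (λ a → mk≋ λ { zero → ℤ.+-inverseʳ (a 0) ; (suc n) → ℤ.+-inverseʳ (a (suc n)) })
          ; ⁻¹-cong = λ p → mk≋ λ n → cong ℤ.-_ (at p n) }
        ; comm = λ a b → mk≋ λ n → ℤ.+-comm (a n) (b n) }
      ; *-cong = λ p r → mk≋ λ n → ⊛-cong≤ n (λ i _ → at p i) (λ i _ → at r i)
      ; *-assoc = λ a b c → mk≋ (⊛-assoc a b c)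
      ; *-identity = identityˡ
                   , (λ a → mk≋ λ n → trans (⊛-comm a (const (+ 1)) n) (at (identityˡ a) n))
      ; distrib = (λ a b c → mk≋ λ n → trans (⊛-comm a (b +ˢ c) n) (trans (⊛-distribʳ b c a n)
                      (cong₂ ℤ._+_ (⊛-comm b a n) (⊛-comm c a n))))
                , (λ a b c → mk≋ (⊛-distribʳ b c a)) }
    ; *-comm = λ a b → mk≋ (⊛-comm a b) }
    where
    identityˡ : ∀ a → const (+ 1) · a ≋ a
    identityˡ a = mk≋ λ n → trans (const-⊛ (+ 1) a n) (ℤ.*-identityˡ (a n))

seriesRing : CommutativeRing _ _
seriesRing = record { isCommutativeRing = seriesIsCommutativeRing }

seriesACR : AlmostCommutativeRing _ _
seriesACR = fromCommutativeRing seriesRing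

-- The ring solver takes its coefficients from ℤ through `const`, so numerals in series identities
-- are computed as integers.
const-morphism : CommutativeRing.rawRing ℤ.+-*-commutativeRing -Raw-AlmostCommutative⟶ seriesACR
const-morphism = record
  { ⟦_⟧ = const ; +-homo = const-+ ; *-homo = const-* ; -‿homo = const-neg
  ; 0-homo = ≋-refl ; 1-homo = ≋-refl }

const≟ : ∀ j k → Maybe (const j ≋ const k)
const≟ j k with j ℤ.≟ k
... | yes refl = just ≋-refl
... | no  _    = nothing

module SeriesSolver = Algebra.Solver.Ring
  (CommutativeRing.rawRing ℤ.+-*-commutativeRing) seriesACR const-morphism const≟

open import Algebra.Properties.CommutativeSemiring.Exp
  (CommutativeRing.commutativeSemiring seriesRing)
  using (_^_; ^-homo-*; ^-assocʳ; ^-congˡ; ^-distrib-*)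

module SR = CommutativeRing seriesRing
module ≋-Reasoning = SetoidReasoning SR.setoid

-- q-adic limits and congruences

-- Congruence modulo q^(n+1). The bound here is inclusive while that of `Ord` is strict, so it is a
-- series of `Ord (suc n)` that is invisible to `Agree n`.
record Agree (n : ℕ) (a b : Series) : Set where
  constructor agree
  field upto : ∀ i → i ℕ.≤ n → a i ≡ b i
open Agree

record Ord (n : ℕ) (a : Series) : Set where
  constructor ord
  field below : ∀ i → i ℕ.< n → a i ≡ + 0
open Ord

≋⇒Agree : ∀ {n a b} → a ≋ b → Agree n a b
≋⇒Agree p = agree λ i _ → at p i

Agree-sym : ∀ {n a b} → Agree n a b → Agree n b a
Agree-sym p = agree λ i i≤n → sym (upto p i i≤n)

Agree-trans : ∀ {n a b c} → Agree n a b → Agree n b c → Agree n a c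
Agree-trans p r = agree λ i i≤n → trans (upto p i i≤n) (upto r i i≤n)

Agree-weaken : ∀ {m n a b} → m ℕ.≤ n → Agree n a b → Agree m a b
Agree-weaken m≤n p = agree λ i i≤m → upto p i (ℕ.≤-trans i≤m m≤n)

opaque
  unfolding _·_

  Agree-· : ∀ {n a a′ b b′} → Agree n a a′ → Agree n b b′ → Agree n (a · b) (a′ · b′)
  Agree-· p r = agree λ i i≤n → ⊛-cong≤ i (λ j j≤i → upto p j (ℕ.≤-trans j≤i i≤n))
                                          (λ j j≤i → upto r j (ℕ.≤-trans j≤i i≤n))

  Agree-+ : ∀ {n a a′ b b′} → Agree n a a′ → Agree n b b′ → Agree n (a +ˢ b) (a′ +ˢ b′)
  Agree-+ p r = agree λ i i≤n → cong₂ ℤ._+_ (upto p i i≤n) (upto r i i≤n)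

  Ord-· : ∀ {m n a b} → Ord m a → Ord n b → Ord (m ℕ.+ n) (a · b)
  Ord-· {m} {n} {a} {b} p r = ord λ j j<m+n → sumTo-zero (suc j) λ i i<1+j → term j j<m+n i (ℕ.≤-pred i<1+j)
    where
    term : ∀ j → j ℕ.< m ℕ.+ n → ∀ i → i ℕ.≤ j → a i ℤ.* b (j ℕ.∸ i) ≡ + 0
    term j j<m+n i i≤j with i ℕ.<? m
    ... | yes i<m = cong (ℤ._* b (j ℕ.∸ i)) (below p i i<m)
    ... | no  i≮m = trans (cong (a i ℤ.*_) (below r (j ℕ.∸ i) j∸i<n)) (ℤ.*-zeroʳ (a i))
      where
      j∸i<n : j ℕ.∸ i ℕ.< n
      j∸i<n = ℕ.+-cancelˡ-< i _ _ (ℕ.≤-<-trans (ℕ.≤-reflexive (ℕ.m+[n∸m]≡n i≤j))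
        (ℕ.<-≤-trans j<m+n (ℕ.+-monoˡ-≤ n (ℕ.≮⇒≥ i≮m))))

  Ord-+ : ∀ {n a b} → Ord n a → Ord n b → Ord n (a +ˢ b)
  Ord-+ p r = ord λ i i<n → cong₂ ℤ._+_ (below p i i<n) (below r i i<n)

  Ord-neg : ∀ {n a} → Ord n a → Ord n (-ˢ a)
  Ord-neg p = ord λ i i<n → cong ℤ.-_ (below p i i<n)

  Agree-+Ord : ∀ {n a b} → Ord (suc n) b → Agree n (a +ˢ b) a
  Agree-+Ord {a = a} p = agree λ i i≤n →
    trans (cong (λ t → a i ℤ.+ t) (below p i (ℕ.s≤s i≤n))) (ℤ.+-identityʳ (a i))

Ord-0 : ∀ {a} → Ord 0 a
Ord-0 = ord λ _ ()

Ord-resp : ∀ {n a b} → a ≋ b → Ord n a → Ord n b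
Ord-resp p r = ord λ i i<n → trans (sym (at p i)) (below r i i<n)

Ord-weaken : ∀ {m n a} → m ℕ.≤ n → Ord n a → Ord m a
Ord-weaken m≤n p = ord λ i i<m → below p i (ℕ.<-≤-trans i<m m≤n)

Ord-·ʳ : ∀ {n a} b → Ord n a → Ord n (a · b)
Ord-·ʳ {n} b p = Ord-weaken (ℕ.m≤m+n n 0) (Ord-· p (Ord-0 {b}))

Ord-·ˡ : ∀ {n b} a → Ord n b → Ord n (a · b)
Ord-·ˡ {n} a p = Ord-· (Ord-0 {a}) p

Ord-^ : ∀ {x} → Ord 1 x → ∀ k → Ord k (x ^ k)
Ord-^ p zero    = Ord-0
Ord-^ p (suc k) = Ord-· p (Ord-^ p k)

infix 4 _⟶_
record _⟶_ (u : ℕ → Series) (a : Series) : Set where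
  constructor converges
  field eventually : ∀ n → Σ ℕ λ N₀ → ∀ N → N₀ ℕ.≤ N → Agree n (u N) a
open _⟶_

module _ {u v : ℕ → Series} {a b : Series} where

  ⟶-· : u ⟶ a → v ⟶ b → (λ N → u N · v N) ⟶ a · b
  ⟶-· p r = converges λ n → let (N , hN) = eventually p n ; (M , hM) = eventually r n in
    N ℕ.⊔ M , λ K le → Agree-· (hN K (ℕ.≤-trans (ℕ.m≤m⊔n N M) le)) (hM K (ℕ.≤-trans (ℕ.m≤n⊔m N M) le))

  ⟶-+ : u ⟶ a → v ⟶ b → (λ N → u N +ˢ v N) ⟶ a +ˢ b
  ⟶-+ p r = converges λ n → let (N , hN) = eventually p n ; (M , hM) = eventually r n in
    N ℕ.⊔ M , λ K le → Agree-+ (hN K (ℕ.≤-trans (ℕ.m≤m⊔n N M) le)) (hM K (ℕ.≤-trans (ℕ.m≤n⊔m N M) le))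

⟶-const : ∀ a → (λ _ → a) ⟶ a
⟶-const a = converges λ n → 0 , λ _ _ → ≋⇒Agree ≋-refl

⟶-unique : ∀ {u a b} → u ⟶ a → u ⟶ b → a ≋ b
⟶-unique p r = mk≋ λ n → let (N , hN) = eventually p n ; (M , hM) = eventually r n in
  trans (sym (upto (hN (N ℕ.⊔ M) (ℕ.m≤m⊔n N M)) n ℕ.≤-refl)) (upto (hM (N ℕ.⊔ M) (ℕ.m≤n⊔m N M)) n ℕ.≤-refl)

⟶-agree : ∀ {u v a} → (∀ N → Agree N (u N) (v N)) → u ⟶ a → v ⟶ a
⟶-agree e p = converges λ n → let (N , hN) = eventually p n in
  N ℕ.⊔ n , λ K le → Agree-trans
    (Agree-sym (Agree-weaken (ℕ.≤-trans (ℕ.m≤n⊔m N n) le) (e K))) (hN K (ℕ.≤-trans (ℕ.m≤m⊔n N n) le))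

⟶-resp : ∀ {u v a} → (∀ N → u N ≋ v N) → u ⟶ a → v ⟶ a
⟶-resp e = ⟶-agree λ N → ≋⇒Agree (e N)

⟶-resp-lim : ∀ {u a b} → a ≋ b → u ⟶ a → u ⟶ b
⟶-resp-lim e p = converges λ n → let (N , hN) = eventually p n in
  N , λ K le → Agree-trans (hN K le) (≋⇒Agree e)

⟶-≋ : ∀ {u v a b} → (∀ N → u N ≋ v N) → u ⟶ a → v ⟶ b → a ≋ b
⟶-≋ e p r = ⟶-unique (⟶-resp e p) r

⟶-sub : ∀ {u a} (g : ℕ → ℕ) → (∀ n → n ℕ.≤ g n) → u ⟶ a → (λ N → u (g N)) ⟶ a
⟶-sub g h p = converges λ n → let (N , hN) = eventually p n in
  N , λ K le → hN (g K) (ℕ.≤-trans le (h K))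

-- The q-adic limit of a sequence in which the step from `u N` to `u (suc N)` leaves the
-- coefficients up to N fixed; `f` is defined by the same diagonal.
diag : (ℕ → Series) → Series
diag u n = u n n

module _ {u : ℕ → Series} (cauchy : ∀ N → Agree N (u (suc N)) (u N)) where

  Agree-+steps : ∀ n d → Agree n (u (d ℕ.+ n)) (u n)
  Agree-+steps n zero    = ≋⇒Agree ≋-refl
  Agree-+steps n (suc d) =
    Agree-trans (Agree-weaken (ℕ.m≤n+m n d) (cauchy (d ℕ.+ n))) (Agree-+steps n d)

  Agree-stable : ∀ {n N} → n ℕ.≤ N → Agree n (u N) (u n)
  Agree-stable {n} {N} n≤N =
    subst (λ K → Agree n (u K) (u n)) (ℕ.m∸n+n≡m n≤N) (Agree-+steps n (N ℕ.∸ n))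

  ⟶-diag : u ⟶ diag u
  ⟶-diag = converges λ n → n , λ N n≤N → agree λ i i≤n →
    upto (Agree-stable (ℕ.≤-trans i≤n n≤N)) i ℕ.≤-refl

  diag-agree : ∀ n → Agree n (diag u) (u n)
  diag-agree n = agree λ i i≤n → sym (upto (Agree-stable i≤n) i ℕ.≤-refl)

infix 4 _≈[_]_
-- The quotient is kept as a series because it is used as such later: the one for modulus 2 serves
-- as half of `CP3-odd`.
record _≈[_]_ (a : Series) (M : ℤ) (b : Series) : Set where
  constructor mod
  field
    quot : Series
    eq   : a ≋ b +ˢ const M · quot
open _≈[_]_

open SeriesSolver using (solve; con; _:+_; _:*_; _:^_; :-_; _:=_)

≋⇒≈ : ∀ {a b} M → a ≋ b → a ≈[ M ] b
≋⇒≈ {a} {b} M p = mod (const (+ 0)) (≋-trans p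
  (solve 2 (λ b m → b := b :+ m :* con (+ 0)) ≋-refl b (const M)))

≈-sym : ∀ {M a b} → a ≈[ M ] b → b ≈[ M ] a
≈-sym {M} {a} {b} (mod c p) = mod (-ˢ c) (≋-sym (≋-trans (SR.+-cong p ≋-refl)
  (solve 3 (λ b m c → (b :+ m :* c) :+ m :* (:- c) := b) ≋-refl b (const M) c)))

≈-trans : ∀ {M a b c} → a ≈[ M ] b → b ≈[ M ] c → a ≈[ M ] c
≈-trans {M} {c = c} (mod d p) (mod e r) = mod (e +ˢ d) (≋-trans p (≋-trans (SR.+-cong r ≋-refl)
  (solve 4 (λ c m d e → (c :+ m :* e) :+ m :* d := c :+ m :* (e :+ d)) ≋-refl c (const M) d e)))

≈-+ : ∀ {M a a′ b b′} → a ≈[ M ] a′ → b ≈[ M ] b′ → a +ˢ b ≈[ M ] a′ +ˢ b′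
≈-+ {M} {a′ = a} {b′ = b} (mod d p) (mod e r) = mod (d +ˢ e) (≋-trans (SR.+-cong p r)
  (solve 5 (λ a b m d e → (a :+ m :* d) :+ (b :+ m :* e) := (a :+ b) :+ m :* (d :+ e)) ≋-refl a b (const M) d e))

≈-· : ∀ {M a a′ b b′} → a ≈[ M ] a′ → b ≈[ M ] b′ → a · b ≈[ M ] a′ · b′
≈-· {M} {a′ = a} {b′ = b} (mod d p) (mod e r) = mod (a · e +ˢ d · b +ˢ const M · d · e) (≋-trans (SR.*-cong p r)
  (solve 5 (λ a b m d e → (a :+ m :* d) :* (b :+ m :* e) := a :* b :+ m :* (a :* e :+ d :* b :+ m :* d :* e)) ≋-refl a b (const M) d e))

≈-refl : ∀ {M a} → a ≈[ M ] a
≈-refl {M} = ≋⇒≈ M ≋-refl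

≈-^ : ∀ {M a b} k → a ≈[ M ] b → a ^ k ≈[ M ] b ^ k
≈-^ zero    p = ≈-refl
≈-^ (suc k) p = ≈-· p (≈-^ k p)

≈-scale : ∀ {M a b} k → a ≈[ M ] b → const k · a ≈[ k ℤ.* M ] const k · b
≈-scale {M} {b = b} k (mod d p) = mod d (≋-trans (SR.*-cong ≋-refl p)
  (≋-trans (solve 4 (λ k b m d → k :* (b :+ m :* d) := k :* b :+ (k :* m) :* d) ≋-refl (const k) b (const M) d)
    (SR.+-cong ≋-refl (SR.*-cong (≋-sym (const-* k M)) ≋-refl))))

≈-weaken : ∀ {M a b} k → a ≈[ k ℤ.* M ] b → a ≈[ M ] b
≈-weaken {M} {b = b} k (mod d p) = mod (const k · d) (≋-trans p
  (≋-trans (SR.+-cong ≋-refl (SR.*-cong (const-* k M) ≋-refl))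
    (solve 4 (λ k b m d → b :+ (k :* m) :* d := b :+ m :* (k :* d)) ≋-refl (const k) b (const M) d)))

-- (b + 2kd)² = b² + 4k(bd + kd²)
≈-square : ∀ {a b} k → a ≈[ + 2 ℤ.* k ] b → a ^ 2 ≈[ + 4 ℤ.* k ] b ^ 2
≈-square {b = b} k (mod d p) = mod (b · d +ˢ const k · d ^ 2) (≋-trans (^-congˡ 2 (≋-trans p
    (SR.+-cong ≋-refl (SR.*-cong (const-* (+ 2) k) ≋-refl))))
  (≋-trans (solve 3 (λ b k d → (b :+ (con (+ 2) :* k) :* d) :^ 2 :=
      b :^ 2 :+ (con (+ 4) :* k) :* (b :* d :+ k :* d :^ 2)) ≋-refl b (const k) d)
    (SR.+-cong ≋-refl (SR.*-cong (≋-sym (const-* (+ 4) k)) ≋-refl))))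

-- The quotients along the sequences need not converge. Multiplication by `const M` acts
-- coefficientwise, so coefficient n of the new quotient may come from any stage at which both
-- sequences have settled up to n.
⟶-≈ : ∀ {M u v a b} → (∀ N → u N ≈[ M ] v N) → u ⟶ a → v ⟶ b → a ≈[ M ] b
⟶-≈ {M} {u} {v} {a} {b} e p r = mod (λ n → quot (e (K n)) n) (mk≋ λ n →
  trans (sym (upto (proj₂ (eventually p n) (K n) (ℕ.m≤m⊔n _ _)) n ℕ.≤-refl))
  (trans (at (eq (e (K n))) n) (trans (+ˢ-at (v (K n)) _ n)
    (trans (cong₂ ℤ._+_ (upto (proj₂ (eventually r n) (K n) (ℕ.m≤n⊔m _ _)) n ℕ.≤-refl)
      (trans (const-· M (quot (e (K n))) n) (sym (const-· M (λ n → quot (e (K n)) n) n))))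
      (sym (+ˢ-at b _ n))))))
  where
  K : ℕ → ℕ
  K n = proj₁ (eventually p n) ℕ.⊔ proj₁ (eventually r n)

-- Gauss's theta series as products

^-≡ : ∀ x {m n} → m ≡ n → x ^ m ≋ x ^ n
^-≡ x refl = ≋-refl

·-cong : ∀ {a a′ b b′} → a ≋ a′ → b ≋ b′ → a · b ≋ a′ · b′
·-cong = SR.*-cong

+-cong : ∀ {a a′ b b′} → a ≋ a′ → b ≋ b′ → a +ˢ b ≋ a′ +ˢ b′
+-cong = SR.+-cong

-- (a; X)_n
poch : Series → Series → ℕ → Series
poch a X zero    = const (+ 1)
poch a X (suc n) = poch a X n · (const (+ 1) +ˢ -ˢ (a · X ^ n))

poch-cong : ∀ {a a′ X X′} → a ≋ a′ → X ≋ X′ → ∀ n → poch a X n ≋ poch a′ X′ n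
poch-cong p r zero    = ≋-refl
poch-cong p r (suc n) =
  ·-cong (poch-cong p r n) (+-cong ≋-refl (SR.-‿cong (·-cong p (^-congˡ n r))))

poch-head : ∀ a X n → poch a X (suc n) ≋ (const (+ 1) +ˢ -ˢ a) · poch (X · a) X n
poch-head a X zero    = solve 1 (λ a → con (+ 1) :* (con (+ 1) :+ :- (a :* con (+ 1)))
                                    := (con (+ 1) :+ :- a) :* con (+ 1)) ≋-refl a
poch-head a X (suc n) = ≋-trans (·-cong (poch-head a X n) ≋-refl)
  (solve 4 (λ a X p y → (con (+ 1) :+ :- a) :* p :* (con (+ 1) :+ :- (a :* (X :* y)))
                      := (con (+ 1) :+ :- a) :* (p :* (con (+ 1) :+ :- ((X :* a) :* y))))
    ≋-refl a X (poch (X · a) X n) (X ^ n))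

-- (x; x)_∞, with the intended meaning when `x` has zero constant term.
P : Series → Series
P x = diag (poch x x)

module _ {x : Series} (x₀ : Ord 1 x) where

  ⟶-P : poch x x ⟶ P x
  ⟶-P = ⟶-diag λ N → Agree-trans
    (≋⇒Agree (solve 2 (λ p y → p :* (con (+ 1) :+ :- y) := p :+ :- (p :* y)) ≋-refl (poch x x N) (x · x ^ N)))
    (Agree-+Ord (Ord-neg (Ord-·ˡ (poch x x N) (Ord-^ x₀ (suc N)))))

  P-cong : ∀ {y} → x ≋ y → P x ≋ P y
  P-cong e = mk≋ λ n → at (poch-cong e e n) n

-- Both of Gauss's theta series are summed by one telescoping argument (after Shanks):
-- with X = c w, the sums Rₙ = Σ_{s≤n} (X^{s+1};X)_{n-s} (c;X)_s w^s X^{sn} satisfy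
-- Rₙ₊₁ = (1 - w Xⁿ) Rₙ + (c;X)ₙ₊₁ wⁿ⁺¹ X^{n(n+1)} (1 + Xⁿ⁺¹).
module Shanks (c w : Series) where

  X : Series
  X = c · w

  -- The summand of index s in Rₙ for n = s + e. Carrying e in place of n - s avoids truncated
  -- subtraction.
  T : ℕ → ℕ → Series
  T s e = poch (X ^ suc s) X e · poch c X s · w ^ s · X ^ (s ℕ.* (s ℕ.+ e))

  -- The telescoping certificate: for fixed n, the summand s of Rₙ₊₁ minus (1 - w Xⁿ) times the
  -- summand s of Rₙ equals the difference of two consecutive values of `U`.
  U : ℕ → ℕ → Series
  U s e = poch (X ^ suc s) X e · poch c X (suc s) · w ^ suc s · X ^ (suc s ℕ.* (s ℕ.+ e))

  -- The part s ≤ m of the sum Rₙ for n = m + e; the complete sum is the case e = 0.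
  R : ℕ → ℕ → Series
  R zero    e = T 0 e
  R (suc m) e = R m (suc e) +ˢ T (suc m) e

  private
    factor : ℕ → Series
    factor n = const (+ 1) +ˢ -ˢ (w · X ^ n)

  T-zero : ∀ e → T 0 (suc e) ≋ factor e · T 0 e +ˢ U 0 e
  T-zero e = ≋-trans
    (solve 4 (λ c w p v → (p :* (con (+ 1) :+ :- (((c :* w) :* con (+ 1)) :* v))) :* con (+ 1) :* con (+ 1) :* con (+ 1)
      := (con (+ 1) :+ :- (w :* v)) :* (p :* con (+ 1) :* con (+ 1) :* con (+ 1))
         :+ p :* (con (+ 1) :* (con (+ 1) :+ :- (c :* con (+ 1)))) :* (w :* con (+ 1)) :* v)
      ≋-refl c w (poch (X ^ 1) X e) (X ^ e))
    (+-cong ≋-refl (·-cong ≋-refl (^-≡ X (sym (ℕ.+-identityʳ e)))))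

  T-suc : ∀ s e → T (suc s) (suc e) +ˢ U s (suc e) ≋ factor (suc s ℕ.+ e) · T (suc s) e +ˢ U (suc s) e
  T-suc s e = ≋-trans (+-cong
      (·-cong (≋-refl {poch (X ^ suc (suc s)) X (suc e) · poch c X (suc s) · w ^ suc s}) eT)
      (·-cong (·-cong (·-cong (≋-trans (poch-head (X ^ suc s) X e) ≋-refl) ≋-refl) ≋-refl) eZ))
    (≋-trans
      (solve 8 (λ c w p o ws y v z →
        (p :* (con (+ 1) :+ :- ((c :* w :* y) :* v))) :* o :* ws :* (y :* z)
          :+ ((con (+ 1) :+ :- y) :* p) :* o :* ws :* z
        := (con (+ 1) :+ :- (w :* (y :* v))) :* (p :* o :* ws :* z)
          :+ p :* (o :* (con (+ 1) :+ :- (c :* y))) :* (w :* ws) :* (y :* v :* z))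
        ≋-refl c w (poch (X ^ suc (suc s)) X e) (poch c X (suc s)) (w ^ suc s) (X ^ suc s) (X ^ e) Z)
      (+-cong (·-cong (+-cong ≋-refl (SR.-‿cong (·-cong ≋-refl (≋-sym eF)))) ≋-refl)
              (·-cong ≋-refl (≋-sym eU))))
    where
    Z = X ^ (suc s ℕ.* (suc s ℕ.+ e))
    eT : X ^ (suc s ℕ.* (suc s ℕ.+ suc e)) ≋ X ^ suc s · Z
    eT = ≋-trans (^-≡ X (solveℕ 2 (λ s e → (conℕ 1 ⊹ s) ×′ ((conℕ 1 ⊹ s) ⊹ (conℕ 1 ⊹ e))
        ≐ (conℕ 1 ⊹ s) ⊹ (conℕ 1 ⊹ s) ×′ ((conℕ 1 ⊹ s) ⊹ e)) refl s e))
      (^-homo-* X (suc s) (suc s ℕ.* (suc s ℕ.+ e)))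
    eZ : X ^ (suc s ℕ.* (s ℕ.+ suc e)) ≋ Z
    eZ = ^-≡ X (cong (suc s ℕ.*_) (ℕ.+-suc s e))
    eF : X ^ (suc s ℕ.+ e) ≋ X ^ suc s · X ^ e
    eF = ^-homo-* X (suc s) e
    eU : X ^ (suc (suc s) ℕ.* (suc s ℕ.+ e)) ≋ X ^ suc s · X ^ e · Z
    eU = ≋-trans (^-homo-* X (suc s ℕ.+ e) (suc s ℕ.* (suc s ℕ.+ e))) (·-cong eF ≋-refl)

  R-step : ∀ m e → R m (suc e) ≋ factor (m ℕ.+ e) · R m e +ˢ U m e
  R-step zero    e = T-zero e
  R-step (suc m) e = ≋-trans
      (+-cong (≋-trans (R-step m (suc e)) (+-cong (·-cong factor-suc ≋-refl) ≋-refl)) ≋-refl)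
    (≋-trans (solve 4 (λ f r u t → f :* r :+ u :+ t := f :* r :+ (t :+ u)) ≋-refl
        (factor (suc m ℕ.+ e)) (R m (suc e)) (U m (suc e)) (T (suc m) (suc e)))
    (≋-trans (+-cong ≋-refl (T-suc m e))
      (solve 4 (λ f r t u → f :* r :+ (f :* t :+ u) := f :* (r :+ t) :+ u) ≋-refl
        (factor (suc m ℕ.+ e)) (R m (suc e)) (T (suc m) e) (U (suc m) e))))
    where
    factor-suc : factor (m ℕ.+ suc e) ≋ factor (suc m ℕ.+ e)
    factor-suc = +-cong ≋-refl (SR.-‿cong (·-cong ≋-refl (^-≡ X (ℕ.+-suc m e))))

  -- The boundary value `U n 0` left by the telescoping, plus the new summand `T (suc n) 0`.
  increment : ℕ → Series
  increment n = poch c X (suc n) · (w ^ suc n · X ^ (suc n ℕ.* n)) · (const (+ 1) +ˢ X ^ suc n)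

  R-suc : ∀ n → R (suc n) 0 ≋ factor n · R n 0 +ˢ increment n
  R-suc n = ≋-trans (+-cong (R-step n 0) ≋-refl) (≋-trans (+-cong (+-cong
      (·-cong (+-cong ≋-refl (SR.-‿cong (·-cong ≋-refl (^-≡ X (ℕ.+-identityʳ n))))) ≋-refl)
      (·-cong ≋-refl (^-≡ X (cong (suc n ℕ.*_) (ℕ.+-identityʳ n)))))
      (·-cong ≋-refl (≋-trans (^-≡ X (trans (cong (suc n ℕ.*_) (ℕ.+-identityʳ (suc n))) (ℕ.*-suc (suc n) n)))
        (^-homo-* X (suc n) (suc n ℕ.* n)))))
    (solve 6 (λ f r o ws z y → (f :* r :+ con (+ 1) :* o :* ws :* z) :+ con (+ 1) :* o :* ws :* (y :* z)
        := f :* r :+ o :* (ws :* z) :* (con (+ 1) :+ y)) ≋-refl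
      (factor n) (R n 0) (poch c X (suc n)) (w ^ suc n) (X ^ (suc n ℕ.* n)) (X ^ suc n)))

  module _ (S : ℕ → Series) (S₀ : S 0 ≋ const (+ 1)) (δ : ℕ → Series)
           (S-suc : ∀ n → S (suc n) ≋ S n +ˢ δ n)
           (increment-δ : ∀ n → poch w X (suc n) · δ n ≋ increment n) where

    -- With `S` the partial sums of a theta series, both sides satisfy the recurrence `R-suc`: the
    -- hypothesis on `δ` says that the new theta terms are the increment divided by (w;X)ₙ₊₁.
    poch-S : ∀ n → poch w X n · S n ≋ R n 0
    poch-S zero    = ≋-trans (·-cong ≋-refl S₀)
      (solve 0 (con (+ 1) :* con (+ 1) := con (+ 1) :* con (+ 1) :* con (+ 1) :* con (+ 1)) ≋-refl)
    poch-S (suc n) = ≋-trans (·-cong ≋-refl (S-suc n)) (≋-trans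
      (solve 4 (λ d f s t → d :* f :* (s :+ t) := f :* (d :* s) :+ d :* f :* t) ≋-refl
        (poch w X n) (factor n) (S n) (δ n))
      (≋-trans (+-cong (·-cong ≋-refl (poch-S n)) (increment-δ n)) (≋-sym (R-suc n))))

  module _ (X₀ : Ord 1 X) (w₀ : Ord 1 w) where

    -- A summand with s ≥ 1 has order at least s + s n > n because of the factor w^s X^(sn), so only
    -- the summand s = 0, which is (X;X)ₙ, is seen up to qⁿ.
    R-agree : ∀ m e → Agree (m ℕ.+ e) (R m e) (T 0 (m ℕ.+ e))
    R-agree zero    e = ≋⇒Agree ≋-refl
    R-agree (suc m) e = Agree-trans
      (Agree-+Ord (Ord-weaken
        (ℕ.s≤s (ℕ.≤-trans (ℕ.m≤m+n (suc m ℕ.+ e) (m ℕ.* (suc m ℕ.+ e))) (ℕ.m≤n+m _ m)))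
        (Ord-resp (SR.sym (SR.*-assoc _ _ _)) (Ord-·ˡ (poch (X ^ suc (suc m)) X e · poch c X (suc m))
          (Ord-· (Ord-^ w₀ (suc m)) (Ord-^ X₀ (suc m ℕ.* (suc m ℕ.+ e))))))))
      (subst (λ k → Agree k (R m (suc e)) (T 0 k)) (ℕ.+-suc m e) (R-agree m (suc e)))

    ⟶-R : (λ n → R n 0) ⟶ P X
    ⟶-R = ⟶-agree (λ n → Agree-sym (Agree-trans
        (subst (λ k → Agree k (R n 0) (T 0 k)) (ℕ.+-identityʳ n) (R-agree n 0))
        (≋⇒Agree (≋-trans (solve 1 (λ p → p :* con (+ 1) :* con (+ 1) :* con (+ 1) := p) ≋-refl (poch (X ^ 1) X n))
          (poch-cong (solve 1 (λ x → x :* con (+ 1) := x) ≋-refl X) ≋-refl n)))))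
      (⟶-P X₀)

-- Sums over ℤ and the two product formulas

Box : (ℤ → Series) → ℕ → Series
Box h zero    = h (+ 0)
Box h (suc N) = Box h N +ˢ (h (+ suc N) +ˢ h -[1+ N ])

-- The sum over ℤ of a family with h k = O(q^|k|) (the predicate Adm); junk for other families.
∑ : (ℤ → Series) → Series
∑ h = diag (Box h)

Adm : (ℤ → Series) → Set
Adm h = ∀ k → Ord ℤ.∣ k ∣ (h k)

⟶-∑ : ∀ {h} → Adm h → Box h ⟶ ∑ h
⟶-∑ {h} ad = ⟶-diag λ N → Agree-+Ord (Ord-+ (ad (+ suc N)) (ad -[1+ N ]))

sq : ℤ → ℕ
sq k = ℤ.∣ k ∣ ℕ.* ℤ.∣ k ∣

-- k (2k + 1): as k runs over ℤ these are the triangular numbers, each once.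
tri : ℤ → ℕ
tri (+ n)    = n ℕ.* (1 ℕ.+ 2 ℕ.* n)
tri -[1+ n ] = suc n ℕ.* (1 ℕ.+ 2 ℕ.* n)

∣k∣≤sq : ∀ k → ℤ.∣ k ∣ ℕ.≤ sq k
∣k∣≤sq (+ zero)  = ℕ.z≤n
∣k∣≤sq (+ suc n) = ℕ.m≤m+n (suc n) _
∣k∣≤sq -[1+ n ]  = ℕ.m≤m+n (suc n) _

∣k∣≤tri : ∀ k → ℤ.∣ k ∣ ℕ.≤ tri k
∣k∣≤tri (+ n)    = ℕ.m≤m*n n (1 ℕ.+ 2 ℕ.* n)
∣k∣≤tri -[1+ n ] = ℕ.m≤m*n (suc n) (1 ℕ.+ 2 ℕ.* n)

φ : Series → Series
φ z = ∑ λ k → z ^ sq k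

ψ : Series → Series
ψ x = ∑ λ k → x ^ tri k

Box-cong : ∀ {g h} → (∀ k → g k ≋ h k) → ∀ N → Box g N ≋ Box h N
Box-cong e zero    = e (+ 0)
Box-cong e (suc N) = +-cong (Box-cong e N) (+-cong (e (+ suc N)) (e -[1+ N ]))

∑-cong : ∀ {g h} → (∀ k → g k ≋ h k) → ∑ g ≋ ∑ h
∑-cong e = mk≋ λ n → at (Box-cong e n) n

φ-cong : ∀ {x y} → x ≋ y → φ x ≋ φ y
φ-cong e = ∑-cong λ k → ^-congˡ (sq k) e

ψ-cong : ∀ {x y} → x ≋ y → ψ x ≋ ψ y
ψ-cong e = ∑-cong λ k → ^-congˡ (tri k) e

Adm-^ : ∀ {z} → Ord 1 z → (e : ℤ → ℕ) → (∀ k → ℤ.∣ k ∣ ℕ.≤ e k) → Adm λ k → z ^ e k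
Adm-^ z₀ e le k = Ord-weaken (le k) (Ord-^ z₀ (e k))

-- The factors of (x;x)₂ₙ are sorted into odd and even exponents.
poch-double : ∀ x n → poch x (x · x) n · poch (x · x) (x · x) n ≋ poch x x (n ℕ.+ n)
poch-double x zero    = solve 0 (con (+ 1) :* con (+ 1) := con (+ 1)) ≋-refl
poch-double x (suc n) = ≋-trans
  (solve 5 (λ a b x y u → (a :* (con (+ 1) :+ :- (x :* y))) :* (b :* (con (+ 1) :+ :- (x :* x :* y)))
      := (a :* b) :* (con (+ 1) :+ :- (x :* y)) :* (con (+ 1) :+ :- (x :* (x :* y))))
    ≋-refl (poch x (x · x) n) (poch (x · x) (x · x) n) x ((x · x) ^ n) x)
  (≋-trans (·-cong (·-cong (poch-double x n) (+-cong ≋-refl (SR.-‿cong (·-cong ≋-refl e))))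
             (+-cong ≋-refl (SR.-‿cong (·-cong ≋-refl (·-cong ≋-refl e)))))
    (subst (λ k → poch x x (n ℕ.+ n) · (const (+ 1) +ˢ -ˢ (x · x ^ (n ℕ.+ n)))
                    · (const (+ 1) +ˢ -ˢ (x · (x · x ^ (n ℕ.+ n)))) ≋ poch x x (suc k))
      (sym (ℕ.+-suc n n)) ≋-refl))
  where
  e : (x · x) ^ n ≋ x ^ (n ℕ.+ n)
  e = ≋-trans (^-distrib-* x x n) (≋-sym (^-homo-* x n n))

poch-neg : ∀ x n → poch x x n · poch (-ˢ x) x n ≋ poch (x · x) (x · x) n
poch-neg x zero    = solve 0 (con (+ 1) :* con (+ 1) := con (+ 1)) ≋-refl
poch-neg x (suc n) = ≋-trans
  (solve 4 (λ a b x y → (a :* (con (+ 1) :+ :- (x :* y))) :* (b :* (con (+ 1) :+ :- ((:- x) :* y)))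
      := (a :* b) :* (con (+ 1) :+ :- (x :* x :* (y :* y))))
    ≋-refl (poch x x n) (poch (-ˢ x) x n) x (x ^ n))
  (·-cong (poch-neg x n) (+-cong ≋-refl (SR.-‿cong (·-cong ≋-refl (≋-sym (^-distrib-* x x n))))))

module _ {x : Series} (x₀ : Ord 1 x) where

  private
    xx₀ : Ord 1 (x · x)
    xx₀ = Ord-·ʳ x x₀

  -- Shanks's sums with c = w = x, hence X = x². The symbols (c;X)ₙ₊₁ and (w;X)ₙ₊₁ coincide, so the
  -- new theta terms are two monomials with triangular exponents. Multiplying by (X;X)ₙ completes
  -- (x;x²)ₙ to (x;x)₂ₙ, which is why `P x` is approached along even indices.
  ψ-product : ψ x · P x ≋ P (x · x) ^ 2
  ψ-product = ⟶-≋ (λ n → step n)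
    (⟶-· (⟶-∑ (Adm-^ x₀ tri ∣k∣≤tri)) (⟶-sub (λ n → n ℕ.+ n) (λ n → ℕ.m≤m+n n n) (⟶-P x₀)))
    (⟶-resp-lim (solve 1 (λ p → p :* p := p :^ 2) ≋-refl (P (x · x)))
      (⟶-· (⟶-R xx₀ x₀) (⟶-P xx₀)))
    where
    open Shanks x x
    S : ℕ → Series
    S = Box λ k → x ^ tri k
    δ : ℕ → Series
    δ n = x ^ tri (+ suc n) +ˢ x ^ tri -[1+ n ]
    δ-eq : ∀ n → δ n ≋ (x ^ suc n · X ^ (suc n ℕ.* n)) · (const (+ 1) +ˢ X ^ suc n)
    δ-eq n = ≋-trans (+-cong
        (≋-trans (^-≡ x (solveℕ 1 (λ n → (conℕ 1 ⊹ n) ×′ (conℕ 1 ⊹ conℕ 2 ×′ (conℕ 1 ⊹ n))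
              ≐ ((conℕ 1 ⊹ n) ⊹ conℕ 2 ×′ ((conℕ 1 ⊹ n) ×′ n)) ⊹ conℕ 2 ×′ (conℕ 1 ⊹ n)) refl n))
          (≋-trans (^-homo-* x (suc n ℕ.+ 2 ℕ.* (suc n ℕ.* n)) (2 ℕ.* suc n))
            (·-cong (≋-trans (^-homo-* x (suc n) (2 ℕ.* (suc n ℕ.* n))) (·-cong ≋-refl (even-^ (suc n ℕ.* n))))
              (even-^ (suc n)))))
        (≋-trans (^-≡ x (solveℕ 1 (λ n → (conℕ 1 ⊹ n) ×′ (conℕ 1 ⊹ conℕ 2 ×′ n)
              ≐ (conℕ 1 ⊹ n) ⊹ conℕ 2 ×′ ((conℕ 1 ⊹ n) ×′ n)) refl n))
          (≋-trans (^-homo-* x (suc n) (2 ℕ.* (suc n ℕ.* n))) (·-cong ≋-refl (even-^ (suc n ℕ.* n))))))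
      (solve 2 (λ a b → a :* b :+ a := a :* (con (+ 1) :+ b)) ≋-refl (x ^ suc n · X ^ (suc n ℕ.* n)) (X ^ suc n))
      where
      even-^ : ∀ m → x ^ (2 ℕ.* m) ≋ X ^ m
      even-^ m = ≋-trans (≋-sym (^-assocʳ x 2 m))
        (^-congˡ m (solve 1 (λ x → x :^ 2 := x :* x) ≋-refl x))
    step : ∀ n → S n · poch x x (n ℕ.+ n) ≋ R n 0 · poch X X n
    step n = ≋-trans (·-cong ≋-refl (≋-sym (poch-double x n)))
      (≋-trans (solve 3 (λ s o p → s :* (o :* p) := (o :* s) :* p) ≋-refl (S n) (poch x X n) (poch X X n))
        (·-cong (poch-S S ≋-refl δ (λ _ → ≋-refl)
          (λ n → ≋-trans (·-cong ≋-refl (δ-eq n)) (SR.sym (SR.*-assoc _ _ _))) n) ≋-refl))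

  -- Shanks's sums with c = -1 and w = -x, hence X = x. The ratio of (-1;x)ₙ₊₁ (1 + xⁿ⁺¹) to
  -- (-x;x)ₙ₊₁ is 2, and this 2 is the pair of equal theta terms at n + 1 and -(n + 1).
  φ-product : φ (-ˢ x) · P (x · x) ≋ P x ^ 2
  φ-product = ⟶-≋ step
    (⟶-· (⟶-∑ (Adm-^ (Ord-neg x₀) sq ∣k∣≤sq)) (⟶-P xx₀))
    (⟶-resp-lim (solve 1 (λ p → p :* p := p :^ 2) ≋-refl (P x))
      (⟶-· (⟶-resp-lim (P-cong (Ord-resp (≋-sym X≋x) x₀) X≋x) (⟶-R (Ord-resp (≋-sym X≋x) x₀) (Ord-neg x₀))) (⟶-P x₀)))
    where
    open Shanks (const -[1+ 0 ]) (-ˢ x)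
    X≋x : X ≋ x
    X≋x = solve 1 (λ x → con -[1+ 0 ] :* (:- x) := x) ≋-refl x
    S : ℕ → Series
    S = Box λ k → (-ˢ x) ^ sq k
    δ : ℕ → Series
    δ n = (-ˢ x) ^ sq (+ suc n) +ˢ (-ˢ x) ^ sq -[1+ n ]
    -- The exponent n(n+1) is even, so the sign of -x disappears.
    pronic : ∀ n → (-ˢ x) ^ (suc n ℕ.* n) ≋ X ^ (suc n ℕ.* n)
    pronic zero    = ≋-refl
    pronic (suc n) = ≋-trans (split (-ˢ x)) (≋-trans (·-cong (pronic n)
      (≋-trans (≋-sym (^-assocʳ (-ˢ x) 2 (suc n))) (≋-trans
        (^-congˡ (suc n) (solve 1 (λ x → (:- x) :^ 2 := (con -[1+ 0 ] :* (:- x)) :^ 2) ≋-refl x)) (^-assocʳ X 2 (suc n)))))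
      (≋-sym (split X)))
      where
      split : ∀ y → y ^ (suc (suc n) ℕ.* suc n) ≋ y ^ (suc n ℕ.* n) · y ^ (2 ℕ.* suc n)
      split y = ≋-trans (^-≡ y (solveℕ 1 (λ n → (conℕ 2 ⊹ n) ×′ (conℕ 1 ⊹ n)
          ≐ (conℕ 1 ⊹ n) ×′ n ⊹ conℕ 2 ×′ (conℕ 1 ⊹ n)) refl n)) (^-homo-* y (suc n ℕ.* n) (2 ℕ.* suc n))
    δ-eq : ∀ n → δ n ≋ const (+ 2) · ((-ˢ x) ^ suc n · X ^ (suc n ℕ.* n))
    δ-eq n = ≋-trans (solve 1 (λ a → a :+ a := con (+ 2) :* a) ≋-refl ((-ˢ x) ^ (suc n ℕ.* suc n)))
      (·-cong ≋-refl (≋-trans (^-≡ (-ˢ x) (ℕ.*-suc (suc n) n))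
        (≋-trans (^-homo-* (-ˢ x) (suc n) (suc n ℕ.* n)) (·-cong ≋-refl (pronic n)))))
    -- (-1;x)_{n+2} = 2 (-x;x)_{n+1}
    shift : ∀ n → const (+ 2) · poch (-ˢ x) X (suc n) ≋ poch (const -[1+ 0 ]) X (suc n) · (const (+ 1) +ˢ X ^ suc n)
    shift n = ≋-trans (·-cong ≋-refl (poch-cong
        (solve 1 (λ x → :- x := (con -[1+ 0 ] :* (:- x)) :* con -[1+ 0 ]) ≋-refl x) ≋-refl (suc n)))
      (≋-trans (≋-sym (≋-trans (poch-head (const -[1+ 0 ]) X (suc n))
        (·-cong (solve 0 (con (+ 1) :+ :- con -[1+ 0 ] := con (+ 2)) ≋-refl) ≋-refl)))
        (·-cong ≋-refl (solve 1 (λ y → con (+ 1) :+ :- (con -[1+ 0 ] :* y) := con (+ 1) :+ y) ≋-refl (X ^ suc n))))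
    step : ∀ n → S n · poch (x · x) (x · x) n ≋ R n 0 · poch x x n
    step n = ≋-trans (·-cong ≋-refl (≋-sym (poch-neg x n)))
      (≋-trans (solve 3 (λ s o p → s :* (p :* o) := (o :* s) :* p) ≋-refl (S n) (poch (-ˢ x) x n) (poch x x n))
        (·-cong (≋-trans (·-cong (poch-cong ≋-refl (≋-sym X≋x) n) ≋-refl)
          (poch-S S ≋-refl δ (λ _ → ≋-refl)
            (λ n → ≋-trans (·-cong ≋-refl (δ-eq n)) (≋-trans
              (solve 3 (λ d t a → d :* (t :* a) := t :* d :* a) ≋-refl (poch (-ˢ x) X (suc n)) (const (+ 2)) ((-ˢ x) ^ suc n · X ^ (suc n ℕ.* n)))
              (≋-trans (·-cong (shift n) ≋-refl)
                (solve 3 (λ o e a → o :* e :* a := o :* a :* e) ≋-refl (poch (const -[1+ 0 ]) X (suc n)) (const (+ 1) +ˢ X ^ suc n)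
                  ((-ˢ x) ^ suc n · X ^ (suc n ℕ.* n)))))) n)) ≋-refl))

  -- The even-exponent factors (x²;x²) occur in both P(x) and P(-x). The odd-exponent ones multiply
  -- to (x²;x⁴), which P(x⁴) completes to a third copy of P(x²).
  P-neg : P x · P (-ˢ x) · P ((x · x) · (x · x)) ≋ P (x · x) ^ 3
  P-neg = ⟶-≋ step
    (⟶-· (⟶-· (⟶-sub (λ n → n ℕ.+ n) (λ n → ℕ.m≤m+n n n) (⟶-P x₀))
                (⟶-sub (λ n → n ℕ.+ n) (λ n → ℕ.m≤m+n n n) (⟶-P (Ord-neg x₀))))
         (⟶-P (Ord-·ʳ (x · x) xx₀)))
    (⟶-resp-lim (solve 1 (λ p → p :* (p :* p) := p :^ 3) ≋-refl (P (x · x)))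
      (⟶-· (⟶-sub (λ n → n ℕ.+ n) (λ n → ℕ.m≤m+n n n) (⟶-P xx₀)) (⟶-· (⟶-P xx₀) (⟶-P xx₀))))
    where
    y = x · x
    neg-square : (-ˢ x) · (-ˢ x) ≋ y
    neg-square = solve 1 (λ x → (:- x) :* (:- x) := x :* x) ≋-refl x
    odd-pair : ∀ n → poch x y n · poch (-ˢ x) y n ≋ poch y (y · y) n
    odd-pair zero    = solve 0 (con (+ 1) :* con (+ 1) := con (+ 1)) ≋-refl
    odd-pair (suc n) = ≋-trans
      (solve 4 (λ a b x v → (a :* (con (+ 1) :+ :- (x :* v))) :* (b :* (con (+ 1) :+ :- ((:- x) :* v)))
          := (a :* b) :* (con (+ 1) :+ :- (x :* x :* (v :* v)))) ≋-refl (poch x y n) (poch (-ˢ x) y n) x (y ^ n))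
      (·-cong (odd-pair n) (+-cong ≋-refl (SR.-‿cong (·-cong ≋-refl (≋-sym (^-distrib-* y y n))))))
    step : ∀ n → poch x x (n ℕ.+ n) · poch (-ˢ x) (-ˢ x) (n ℕ.+ n) · poch (y · y) (y · y) n
               ≋ poch y y (n ℕ.+ n) · (poch y y n · poch y y n)
    step n = ≋-trans (·-cong (·-cong (≋-sym (poch-double x n)) (≋-sym (≋-trans
        (·-cong (poch-cong ≋-refl (≋-sym neg-square) n) (poch-cong (≋-sym neg-square) (≋-sym neg-square) n))
        (poch-double (-ˢ x) n)))) ≋-refl)
      (≋-trans (solve 4 (λ a b p r → (a :* p) :* (b :* p) :* r := (a :* b) :* r :* (p :* p)) ≋-refl
          (poch x y n) (poch (-ˢ x) y n) (poch y y n) (poch (y · y) (y · y) n))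
        (·-cong (≋-trans (·-cong (odd-pair n) ≋-refl) (poch-double y n)) ≋-refl))

  -- Modulo 2 one copy of each factor 1 - x^k may be replaced by 1 + x^k, and their product is 1 -
  -- x^(2k).
  P-square-mod2 : P x ^ 2 ≈[ + 2 ] P (x · x)
  P-square-mod2 = ⟶-≈ (λ n → ≈-trans (step n) (≋⇒≈ (+ 2) (poch-neg x n)))
    (⟶-resp-lim (solve 1 (λ p → p :* p := p :^ 2) ≋-refl (P x)) (⟶-· (⟶-P x₀) (⟶-P x₀)))
    (⟶-P xx₀)
    where
    neg-≈ : ∀ a → a ≈[ + 2 ] -ˢ a
    neg-≈ a = mod a (solve 1 (λ a → a := (:- a) :+ con (+ 2) :* a) ≋-refl a)
    sign : ∀ n → poch x x n ≈[ + 2 ] poch (-ˢ x) x n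
    sign zero    = ≈-refl
    sign (suc n) = ≈-· (sign n) (≈-+ ≈-refl (≈-trans (neg-≈ (-ˢ (x · x ^ n)))
      (≋⇒≈ (+ 2) (solve 2 (λ x y → :- (:- (x :* y)) := :- ((:- x) :* y)) ≋-refl x (x ^ n)))))
    step : ∀ n → poch x x n · poch x x n ≈[ + 2 ] poch x x n · poch (-ˢ x) x n
    step n = ≈-· ≈-refl (sign n)

-- Gauss's formula at x and at -x, with P(x) P(-x) eliminated by `P-neg`. The common factor P(x²)²
-- lets both formulas be applied without division; it is cancelled in `φφ⁻-F`.
φφ-product : ∀ {x} → Ord 1 x → φ x · φ (-ˢ x) · P ((x · x) · (x · x)) ^ 2 · P (x · x) ^ 2 ≋ P (x · x) ^ 6
φφ-product {x} x₀ = ≋-trans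
  (solve 4 (λ a b r y → a :* b :* r :^ 2 :* y :^ 2 := (a :* y) :* (b :* y) :* r :^ 2) ≋-refl (φ x) (φ (-ˢ x)) (P ((x · x) · (x · x))) (P (x · x)))
  (≋-trans (·-cong (·-cong φ⁺ (φ-product x₀)) ≋-refl)
    (≋-trans (solve 3 (λ a b r → b :^ 2 :* a :^ 2 :* r :^ 2 := (a :* b :* r) :^ 2) ≋-refl (P x) (P (-ˢ x)) (P ((x · x) · (x · x))))
      (≋-trans (^-congˡ 2 (P-neg x₀)) (solve 1 (λ y → (y :^ 3) :^ 2 := y :^ 6) ≋-refl (P (x · x))))))
  where
  neg-neg : -ˢ (-ˢ x) ≋ x
  neg-neg = solve 1 (λ x → :- (:- x) := x) ≋-refl x
  neg-square : (-ˢ x) · (-ˢ x) ≋ x · x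
  neg-square = solve 1 (λ x → (:- x) :* (:- x) := x :* x) ≋-refl x
  φ⁺ : φ x · P (x · x) ≋ P (-ˢ x) ^ 2
  φ⁺ = ≋-trans (·-cong (≋-sym (φ-cong neg-neg)) (≋-sym (P-cong (Ord-·ʳ (-ˢ x) (Ord-neg x₀)) neg-square)))
    (φ-product (Ord-neg x₀))

-- The lattice identity

Box-resp : ∀ {g h a} → (∀ k → g k ≋ h k) → Box g ⟶ a → Box h ⟶ a
Box-resp e = ⟶-resp (Box-cong e)

Box-· : ∀ a h N → Box (λ k → a · h k) N ≋ a · Box h N
Box-· a h zero    = ≋-refl
Box-· a h (suc N) = ≋-trans (+-cong (Box-· a h N) ≋-refl)
  (solve 4 (λ a b u v → a :* b :+ (a :* u :+ a :* v) := a :* (b :+ (u :+ v))) ≋-refl a (Box h N) (h (+ suc N)) (h -[1+ N ]))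

Box-+ : ∀ g h N → Box (λ k → g k +ˢ h k) N ≋ Box g N +ˢ Box h N
Box-+ g h zero    = ≋-refl
Box-+ g h (suc N) = ≋-trans (+-cong (Box-+ g h N) ≋-refl)
  (solve 6 (λ b c u v s t → (b :+ c) :+ ((u :+ s) :+ (v :+ t)) := (b :+ (u :+ v)) :+ (c :+ (s :+ t))) ≋-refl
    (Box g N) (Box h N) (g (+ suc N)) (g -[1+ N ]) (h (+ suc N)) (h -[1+ N ]))

Adm-· : ∀ a {h} → Adm h → Adm λ k → a · h k
Adm-· a ad k = Ord-·ˡ a (ad k)

⟶-·ˡ : ∀ a {h b} → Box h ⟶ b → Box (λ k → a · h k) ⟶ a · b
⟶-·ˡ a {h} p = ⟶-resp (λ N → ≋-sym (Box-· a h N)) (⟶-· (⟶-const a) p)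

∑-·ˡ : ∀ a {h} → Adm h → ∑ (λ k → a · h k) ≋ a · ∑ h
∑-·ˡ a ad = ⟶-unique (⟶-∑ (Adm-· a ad)) (⟶-·ˡ a (⟶-∑ ad))

∑-·ʳ : ∀ a {h} → Adm h → ∑ (λ k → h k · a) ≋ ∑ h · a
∑-·ʳ a ad = ≋-trans (∑-cong λ k → SR.*-comm _ _) (≋-trans (∑-·ˡ a ad) (SR.*-comm _ _))

Box-agree : ∀ {n g h} → (∀ k → Agree n (g k) (h k)) → ∀ N → Agree n (Box g N) (Box h N)
Box-agree e zero    = e (+ 0)
Box-agree e (suc N) = Agree-+ (Box-agree e N) (Agree-+ (e (+ suc N)) (e -[1+ N ]))

Box-swap : ∀ (g : ℤ → ℤ → Series) M N →
           Box (λ k → Box (λ l → g k l) N) M ≋ Box (λ l → Box (λ k → g k l) M) N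
Box-swap g zero    N = ≋-refl
Box-swap g (suc M) N = ≋-trans (+-cong (Box-swap g M N) (≋-sym (Box-+ (g (+ suc M)) (g -[1+ M ]) N)))
  (≋-sym (Box-+ (λ l → Box (λ k → g k l) M) (λ l → g (+ suc M) l +ˢ g -[1+ M ] l) N))

∑-agree : ∀ {h} → Adm h → ∀ n → Agree n (∑ h) (Box h n)
∑-agree {h} ad = diag-agree λ N → Agree-+Ord (Ord-+ (ad (+ suc N)) (ad -[1+ N ]))

-- Up to qⁿ either iterated sum equals the finite sum over |k|, |l| ≤ n, where the order of
-- summation is immaterial.
∑-swap : ∀ (g : ℤ → ℤ → Series) → (∀ k → Adm (g k)) → (∀ l → Adm λ k → g k l) →
         ∑ (λ k → ∑ λ l → g k l) ≋ ∑ (λ l → ∑ λ k → g k l)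
∑-swap g adˡ adʳ = mk≋ λ n → upto (Agree-trans (Box-agree (λ k → ∑-agree (adˡ k) n) n)
  (Agree-trans (≋⇒Agree (Box-swap g n n)) (Agree-sym (Box-agree (λ l → ∑-agree (adʳ l) n) n)))) n ℕ.≤-refl

Ord-Box : ∀ {n h} → (∀ k → Ord n (h k)) → ∀ N → Ord n (Box h N)
Ord-Box p zero    = p (+ 0)
Ord-Box p (suc N) = Ord-+ (Ord-Box p N) (Ord-+ (p (+ suc N)) (p -[1+ N ]))

Ord-∑ : ∀ {n h} → (∀ k → Ord n (h k)) → Ord n (∑ h)
Ord-∑ p = ord λ i → below (Ord-Box p i) i

-- A weakening of `Adm` that survives reindexing: the bound by |k| is destroyed by a shift of k,
-- while convergence of the terms to 0 is not.
Null : (ℤ → Series) → Set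
Null h = ∀ n → Σ ℕ λ K → ∀ k → K ℕ.≤ ℤ.∣ k ∣ → Ord n (h k)

Adm⇒Null : ∀ {h} → Adm h → Null h
Adm⇒Null ad n = n , λ k n≤k → Ord-weaken n≤k (ad k)

∣k∣≤1+∣suc-k∣ : ∀ k → ℤ.∣ k ∣ ℕ.≤ suc ℤ.∣ ℤ.suc k ∣
∣k∣≤1+∣suc-k∣ (+ n)          = ℕ.m≤n+m n 2
∣k∣≤1+∣suc-k∣ -[1+ zero ]    = ℕ.≤-refl
∣k∣≤1+∣suc-k∣ -[1+ suc n ]   = ℕ.≤-refl

Null-suc : ∀ {h} → Null h → Null λ k → h (ℤ.suc k)
Null-suc nl n = let (K , hK) = nl n in
  suc K , λ k le → hK (ℤ.suc k) (ℕ.≤-pred (ℕ.≤-trans le (∣k∣≤1+∣suc-k∣ k)))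

Null-neg : ∀ {h} → Null h → Null λ k → h (ℤ.- k)
Null-neg nl n = let (K , hK) = nl n in
  K , λ k le → hK (ℤ.- k) (ℕ.≤-trans le (ℕ.≤-reflexive (sym (ℤ.∣-i∣≡∣i∣ k))))

Box-neg : ∀ h N → Box (λ k → h (ℤ.- k)) N ≋ Box h N
Box-neg h zero    = ≋-refl
Box-neg h (suc N) = +-cong (Box-neg h N) (SR.+-comm _ _)

⟶-neg : ∀ {h a} → Box h ⟶ a → Box (λ k → h (ℤ.- k)) ⟶ a
⟶-neg {h} = ⟶-resp λ N → ≋-sym (Box-neg h N)

suc-negsuc : ∀ n → ℤ.suc -[1+ n ] ≡ ℤ.- + n
suc-negsuc zero    = refl
suc-negsuc (suc n) = refl

-- The shifted box covers 1 - N, ..., N + 1, so it trades the term at -N for the one at N + 1.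
Box-suc : ∀ h N → Box (λ k → h (ℤ.suc k)) N +ˢ h (ℤ.- + N) ≋ Box h N +ˢ h (+ suc N)
Box-suc h zero    = SR.+-comm _ _
Box-suc h (suc N) = ≋-trans
  (+-cong (+-cong (≋-refl {Box (λ k → h (ℤ.suc k)) N})
    (+-cong (≋-refl {h (+ suc (suc N))}) (SR.reflexive (cong h (suc-negsuc N))))) (≋-refl {h -[1+ N ]}))
  (≋-trans (solve 4 (λ b u v w → (b :+ (u :+ v)) :+ w := (b :+ v) :+ (u :+ w)) ≋-refl
      (Box (λ k → h (ℤ.suc k)) N) (h (+ suc (suc N))) (h (ℤ.- + N)) (h -[1+ N ]))
    (≋-trans (+-cong (Box-suc h N) ≋-refl)
      (solve 4 (λ b u v w → (b :+ v) :+ (u :+ w) := (b :+ (v :+ w)) :+ u) ≋-refl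
        (Box h N) (h (+ suc (suc N))) (h (+ suc N)) (h -[1+ N ]))))

⟶-suc : ∀ {h a} → Null h → Box h ⟶ a → Box (λ k → h (ℤ.suc k)) ⟶ a
⟶-suc {h} nl p = converges λ n →
  let (K , hK) = nl (suc n) ; (M , hM) = eventually p n in
  K ℕ.⊔ M , λ N le → Agree-trans
    (≋⇒Agree (solve 2 (λ x v → x := (x :+ v) :+ :- v) ≋-refl (Box (λ k → h (ℤ.suc k)) N) (h (ℤ.- + N))))
    (Agree-trans (≋⇒Agree (≋-trans (+-cong (Box-suc h N) ≋-refl) (SR.+-assoc _ _ _)))
    (Agree-trans (Agree-+Ord (Ord-+
        (hK (+ suc N) (ℕ.≤-trans (ℕ.m≤m⊔n K M) (ℕ.≤-trans le (ℕ.n≤1+n N))))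
        (Ord-neg (hK (ℤ.- + N) (ℕ.≤-trans (ℕ.m≤m⊔n K M) (ℕ.≤-trans le (ℕ.≤-reflexive (sym (ℤ.∣-i∣≡∣i∣ (+ N))))))))))
      (hM N (ℕ.≤-trans (ℕ.m≤n⊔m K M) le))))

-- The backward shift is the forward shift conjugated by k ↦ -k, under which boxes are invariant.
⟶-pred : ∀ {h a} → Null h → Box h ⟶ a → Box (λ k → h (ℤ.pred k)) ⟶ a
⟶-pred {h} nl p = Box-resp
  (λ k → SR.reflexive (cong h (solveℤ 1 (λ k → ⊟ (conℤ (+ 1) ⊞ ⊟ k) ≗′ conℤ -[1+ 0 ] ⊞ k) refl k)))
  (⟶-neg {λ k → h (ℤ.- (ℤ.suc k))} (⟶-suc {λ k → h (ℤ.- k)} (Null-neg nl) (⟶-neg {h} p)))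

Null-pred : ∀ {h} → Null h → Null λ k → h (ℤ.pred k)
Null-pred {h} nl n = let (K , hK) = Null-neg {λ k → h (ℤ.- (ℤ.suc k))} (Null-suc {λ k → h (ℤ.- k)} (Null-neg {h} nl)) n in
  K , λ k le → subst (λ j → Ord n (h j))
    (solveℤ 1 (λ k → ⊟ (conℤ (+ 1) ⊞ ⊟ k) ≗′ conℤ -[1+ 0 ] ⊞ k) refl k) (hK k le)

⟶-shift : ∀ {h a} → Null h → Box h ⟶ a → ∀ j → Box (λ k → h (k ℤ.+ j)) ⟶ a
⟶-shift {h} nl p (+ zero) = Box-resp (λ k → SR.reflexive (cong h (sym (ℤ.+-identityʳ k)))) p
⟶-shift {h} nl p (+ suc n) = Box-resp
  (λ k → SR.reflexive (cong h (solveℤ 2 (λ k n → conℤ (+ 1) ⊞ (k ⊞ n) ≗′ k ⊞ (conℤ (+ 1) ⊞ n)) refl k (+ n))))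
  (⟶-shift {λ k → h (ℤ.suc k)} (Null-suc nl) (⟶-suc nl p) (+ n))
⟶-shift {h} nl p -[1+ zero ] = Box-resp
  (λ k → SR.reflexive (cong h (ℤ.+-comm -[1+ 0 ] k))) (⟶-pred nl p)
⟶-shift {h} nl p -[1+ suc n ] = Box-resp
  (λ k → SR.reflexive (cong h (solveℤ 2 (λ k n → conℤ -[1+ 0 ] ⊞ (k ⊞ n) ≗′ k ⊞ (conℤ -[1+ 0 ] ⊞ n)) refl k -[1+ n ])))
  (⟶-shift {λ k → h (ℤ.pred k)} (Null-pred nl) (⟶-pred nl p) -[1+ n ])

ev od : (ℤ → Series) → ℤ → Series
ev h k = h (+ 2 ℤ.* k)
od h k = h (+ 1 ℤ.+ + 2 ℤ.* k)

Adm-ev : ∀ {h} → Adm h → Adm (ev h)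
Adm-ev ad k = Ord-weaken (ℕ.≤-trans (ℕ.m≤n*m ℤ.∣ k ∣ 2) (ℕ.≤-reflexive (sym (ℤ.abs-* (+ 2) k)))) (ad (+ 2 ℤ.* k))

∣k∣≤∣1+2k∣ : ∀ k → ℤ.∣ k ∣ ℕ.≤ ℤ.∣ + 1 ℤ.+ + 2 ℤ.* k ∣
∣k∣≤∣1+2k∣ (+ n) = subst (λ i → n ℕ.≤ ℤ.∣ + 1 ℤ.+ i ∣) (ℤ.pos-* 2 n) (ℕ.≤-trans (ℕ.m≤n*m n 2) (ℕ.n≤1+n _))
∣k∣≤∣1+2k∣ -[1+ n ] = subst (suc n ℕ.≤_) (sym (trans (cong ℤ.∣_∣ eq′) (ℤ.∣-i∣≡∣i∣ (+ (1 ℕ.+ 2 ℕ.* n)))))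
  (ℕ.s≤s (ℕ.m≤n*m n 2))
  where
  eq′ : + 1 ℤ.+ + 2 ℤ.* -[1+ n ] ≡ ℤ.- + (1 ℕ.+ 2 ℕ.* n)
  eq′ = trans (cong (λ i → + 1 ℤ.+ + 2 ℤ.* i) {x = -[1+ n ]} {y = ℤ.- (+ 1 ℤ.+ + n)} refl)
    (trans (solveℤ 1 (λ n → conℤ (+ 1) ⊞ conℤ (+ 2) ⊠ (⊟ (conℤ (+ 1) ⊞ n)) ≗′ ⊟ (conℤ (+ 1) ⊞ conℤ (+ 2) ⊠ n)) refl (+ n))
      (cong (λ i → ℤ.- (+ 1 ℤ.+ i)) (sym (ℤ.pos-* 2 n))))

Adm-od : ∀ {h} → Adm h → Adm (od h)
Adm-od ad k = Ord-weaken (∣k∣≤∣1+2k∣ k) (ad (+ 1 ℤ.+ + 2 ℤ.* k))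

-- The indices 2k and 2k + 1 with |k| ≤ N fill -2N, ..., 2N + 1, one short of the symmetric box of
-- radius 2N + 1.
Box-ev-od : ∀ h N → Box (ev h) N +ˢ Box (od h) N ≋ Box h (suc (N ℕ.+ N)) +ˢ -ˢ h -[1+ N ℕ.+ N ]
Box-ev-od h zero    = solve 3 (λ a b c → a :+ b := (a :+ (b :+ c)) :+ :- c) ≋-refl (h (+ 0)) (h (+ 1)) (h -[1+ 0 ])
Box-ev-od h (suc N) = ≋-trans
  (solve 6 (λ e o a b c d → (e :+ (a :+ b)) :+ (o :+ (c :+ d)) := (e :+ o) :+ (a :+ b :+ c :+ d)) ≋-refl
    (Box (ev h) N) (Box (od h) N) (ev h (+ suc N)) (ev h -[1+ N ]) (od h (+ suc N)) (od h -[1+ N ]))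
  (≋-trans (+-cong (Box-ev-od h N) (+-cong (+-cong (+-cong (h-≡ e₁) (h-≡ e₂)) (h-≡ e₃)) (h-≡ e₄)))
    (≋-trans (solve 6 (λ b m a c d f → (b :+ :- m) :+ (a :+ c :+ d :+ m) := ((b :+ (a :+ c)) :+ (d :+ f)) :+ :- f) ≋-refl
      (Box h (suc (N ℕ.+ N))) (h -[1+ N ℕ.+ N ]) (h (+ suc (suc (N ℕ.+ N)))) (h -[1+ suc (N ℕ.+ N) ])
      (h (+ suc (suc (suc (N ℕ.+ N))))) (h -[1+ suc (suc (N ℕ.+ N)) ]))
    (subst (λ K → Box h (suc (suc (suc (N ℕ.+ N)))) +ˢ -ˢ h -[1+ suc (suc (N ℕ.+ N)) ] ≋ Box h (suc (suc K)) +ˢ -ˢ h -[1+ suc K ])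
      (sym (ℕ.+-suc N N)) ≋-refl)))
  where
  h-≡ : ∀ {i j} → i ≡ j → h i ≋ h j
  h-≡ refl = ≋-refl
  e₁ : + 2 ℤ.* + suc N ≡ + suc (suc (N ℕ.+ N))
  e₁ = solveℤ 1 (λ n → conℤ (+ 2) ⊠ (conℤ (+ 1) ⊞ n) ≗′ conℤ (+ 2) ⊞ (n ⊞ n)) refl (+ N)
  e₂ : + 2 ℤ.* -[1+ N ] ≡ -[1+ suc (N ℕ.+ N) ]
  e₂ = solveℤ 1 (λ n → conℤ (+ 2) ⊠ (⊟ (conℤ (+ 1) ⊞ n)) ≗′ ⊟ (conℤ (+ 2) ⊞ (n ⊞ n))) refl (+ N)
  e₃ : + 1 ℤ.+ + 2 ℤ.* + suc N ≡ + suc (suc (suc (N ℕ.+ N)))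
  e₃ = solveℤ 1 (λ n → conℤ (+ 1) ⊞ conℤ (+ 2) ⊠ (conℤ (+ 1) ⊞ n) ≗′ conℤ (+ 3) ⊞ (n ⊞ n)) refl (+ N)
  e₄ : + 1 ℤ.+ + 2 ℤ.* -[1+ N ] ≡ -[1+ N ℕ.+ N ]
  e₄ = solveℤ 1 (λ n → conℤ (+ 1) ⊞ conℤ (+ 2) ⊠ (⊟ (conℤ (+ 1) ⊞ n)) ≗′ ⊟ (conℤ (+ 1) ⊞ (n ⊞ n))) refl (+ N)

∑-ev-od : ∀ {h} → Adm h → ∑ h ≋ ∑ (ev h) +ˢ ∑ (od h)
∑-ev-od {h} ad = ⟶-unique
  (⟶-sub (λ N → suc (N ℕ.+ N)) (λ N → ℕ.≤-trans (ℕ.m≤m+n N N) (ℕ.n≤1+n _)) (⟶-∑ ad))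
  (⟶-agree (λ N → Agree-trans (≋⇒Agree (Box-ev-od h N)) (Agree-+Ord (Ord-neg
      (Ord-weaken (ℕ.s≤s (ℕ.m≤m+n N N)) (ad -[1+ N ℕ.+ N ])))))
    (⟶-+ (⟶-∑ (Adm-ev {h} ad)) (⟶-∑ (Adm-od {h} ad))))

+sq : ∀ k → + sq k ≡ k ℤ.* k
+sq (+ n)    = ℤ.pos-* n n
+sq -[1+ n ] = refl

+tri : ∀ k → + tri k ≡ k ℤ.* (+ 1 ℤ.+ + 2 ℤ.* k)
+tri (+ n)    = trans (ℤ.pos-* n _) (cong (λ i → + n ℤ.* (+ 1 ℤ.+ i)) (ℤ.pos-* 2 n))
+tri -[1+ n ] = trans (ℤ.pos-* (suc n) _) (trans (cong (λ i → + suc n ℤ.* (+ 1 ℤ.+ i)) (ℤ.pos-* 2 n))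
  (solveℤ 1 (λ n → (conℤ (+ 1) ⊞ n) ⊠ (conℤ (+ 1) ⊞ conℤ (+ 2) ⊠ n)
     ≗′ (⊟ (conℤ (+ 1) ⊞ n)) ⊠ (conℤ (+ 1) ⊞ conℤ (+ 2) ⊠ (⊟ (conℤ (+ 1) ⊞ n)))) refl (+ n)))

^-*sq : ∀ x m k → x ^ (m ℕ.* sq k) ≋ (x ^ m) ^ sq k
^-*sq x m k = ≋-sym (^-assocʳ x m (sq k))

sq-even : ∀ k → sq (+ 2 ℤ.* k) ≡ 4 ℕ.* sq k
sq-even k = ℤ.+-injective (trans (+sq (+ 2 ℤ.* k)) (trans
  (solveℤ 1 (λ k → (conℤ (+ 2) ⊠ k) ⊠ (conℤ (+ 2) ⊠ k) ≗′ conℤ (+ 4) ⊠ (k ⊠ k)) refl k)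
  (trans (cong (λ i → + 4 ℤ.* i) (sym (+sq k))) (sym (ℤ.pos-* 4 (sq k))))))

sq-1mod4 : ∀ k → sq (+ 1 ℤ.+ + 2 ℤ.* (+ 2 ℤ.* k)) ≡ 1 ℕ.+ 8 ℕ.* tri k
sq-1mod4 k = ℤ.+-injective (trans (+sq (+ 1 ℤ.+ + 2 ℤ.* (+ 2 ℤ.* k))) (trans
  (solveℤ 1 (λ k → (conℤ (+ 1) ⊞ conℤ (+ 2) ⊠ (conℤ (+ 2) ⊠ k)) ⊠ (conℤ (+ 1) ⊞ conℤ (+ 2) ⊠ (conℤ (+ 2) ⊠ k))
      ≗′ conℤ (+ 1) ⊞ conℤ (+ 8) ⊠ (k ⊠ (conℤ (+ 1) ⊞ conℤ (+ 2) ⊠ k))) refl k)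
  (trans (cong (λ i → + 1 ℤ.+ + 8 ℤ.* i) (sym (+tri k))) (cong (λ i → + 1 ℤ.+ i) (sym (ℤ.pos-* 8 (tri k)))))))

module Gauss {x : Series} (x₀ : Ord 1 x) where

  e : ℤ → Series
  e k = x ^ sq k

  e-adm : Adm e
  e-adm = Adm-^ x₀ sq ∣k∣≤sq

  ∑-ev : ∑ (ev e) ≋ φ (x ^ 4)
  ∑-ev = ∑-cong λ k → ≋-trans (^-≡ x (sq-even k)) (^-*sq x 4 k)

  ∑-1mod4 : ∑ (ev (od e)) ≋ x · ψ (x ^ 8)
  ∑-1mod4 = ≋-trans (∑-cong λ k → ≋-trans (^-≡ x (sq-1mod4 k)) (·-cong ≋-refl (≋-sym (^-assocʳ x 8 (tri k)))))
    (∑-·ˡ x (Adm-^ (Ord-weaken (ℕ.s≤s ℕ.z≤n) (Ord-^ x₀ 8)) tri ∣k∣≤tri))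

  -- squaring identifies 4k + 3 with 4(-1 - k) + 1
  ∑-3mod4 : ∑ (od (od e)) ≋ x · ψ (x ^ 8)
  ∑-3mod4 = ≋-trans (⟶-≋ (λ N → Box-cong (λ k → SR.reflexive (cong (x ^_) (flip k))) N)
      (⟶-∑ (Adm-od {od e} (Adm-od {e} e-adm)))
      (⟶-suc {λ k → ev (od e) (ℤ.- k)} (Null-neg {ev (od e)} (Adm⇒Null adm)) (⟶-neg {ev (od e)} (⟶-∑ adm))))
    ∑-1mod4
    where
    adm : Adm (ev (od e))
    adm = Adm-ev {od e} (Adm-od {e} e-adm)
    flip : ∀ k → sq (+ 1 ℤ.+ + 2 ℤ.* (+ 1 ℤ.+ + 2 ℤ.* k)) ≡ sq (+ 1 ℤ.+ + 2 ℤ.* (+ 2 ℤ.* (ℤ.- (ℤ.suc k))))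
    flip k = cong (λ a → a ℕ.* a) (trans (sym (ℤ.∣-i∣≡∣i∣ (+ 1 ℤ.+ + 2 ℤ.* (+ 1 ℤ.+ + 2 ℤ.* k))))
      (cong ℤ.∣_∣ (solveℤ 1 (λ k → ⊟ (conℤ (+ 1) ⊞ conℤ (+ 2) ⊠ (conℤ (+ 1) ⊞ conℤ (+ 2) ⊠ k))
        ≗′ conℤ (+ 1) ⊞ conℤ (+ 2) ⊠ (conℤ (+ 2) ⊠ (⊟ (conℤ (+ 1) ⊞ k)))) refl k)))

  -- Even k give φ(x⁴). The classes 1 and 3 mod 4 are exchanged by k ↦ -k, and (4k + 1)² = 1 + 8k(2k
  -- + 1) identifies each of them with xψ(x⁸).
  φ-split : φ x ≋ φ (x ^ 4) +ˢ const (+ 2) · (x · ψ (x ^ 8))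
  φ-split = ≋-trans (∑-ev-od {e} e-adm) (≋-trans (+-cong ∑-ev
      (≋-trans (∑-ev-od {od e} (Adm-od {e} e-adm)) (+-cong ∑-1mod4 ∑-3mod4)))
    (solve 2 (λ a b → a :+ (b :+ b) := a :+ con (+ 2) :* b) ≋-refl (φ (x ^ 4)) (x · ψ (x ^ 8))))

  φ-mod2 : φ x ≈[ + 2 ] const (+ 1)
  φ-mod2 = ⟶-≈ step (⟶-∑ {e} e-adm) (⟶-const (const (+ 1)))
    where
    step : ∀ N → Box e N ≈[ + 2 ] const (+ 1)
    step zero    = ≈-refl
    step (suc N) = ≈-trans (≈-+ (step N) (mod (x ^ (suc N ℕ.* suc N))
        (solve 1 (λ y → y :+ y := con (+ 0) :+ con (+ 2) :* y) ≋-refl (x ^ (suc N ℕ.* suc N)))))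
      (≋⇒≈ (+ 2) (solve 0 (con (+ 1) :+ con (+ 0) := con (+ 1)) ≋-refl))

module Lattice {x : Series} (x₀ : Ord 1 x) where

  x³₀ : Ord 1 (x ^ 3)
  x³₀ = Ord-weaken (ℕ.s≤s ℕ.z≤n) (Ord-^ x₀ 3)

  private
    module A = Gauss x₀
    module B = Gauss x³₀

  -- For fixed y this runs, as l varies, through the class of y + 1 mod 4. In the coordinates (m, y)
  -- the double sum for xψ(x²)ψ(x⁶) has exponent m² + 3y² and the single constraint m ≡ y + 1 mod 4.
  m : ℤ → ℤ → ℤ
  m y l = y ℤ.+ + 4 ℤ.* l ℤ.+ + 1

  g : ℤ → ℤ → Series
  g y l = x ^ (sq (m y l) ℕ.+ 3 ℕ.* sq y)

  -- With k = y + l:  1 + 2k(2k+1) + 6l(2l+1) = (y + 4l + 1)² + 3y².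
  shear : ∀ y l → sq (m y l) ℕ.+ 3 ℕ.* sq y ≡ 1 ℕ.+ 2 ℕ.* tri (y ℤ.+ l) ℕ.+ 6 ℕ.* tri l
  shear y l = ℤ.+-injective (begin
    + sq (m y l) ℤ.+ + (3 ℕ.* sq y)
      ≡⟨ cong₂ ℤ._+_ (+sq (m y l)) (trans (ℤ.pos-* 3 (sq y)) (cong (λ i → + 3 ℤ.* i) (+sq y))) ⟩
    m y l ℤ.* m y l ℤ.+ + 3 ℤ.* (y ℤ.* y)
      ≡⟨ solveℤ 2 (λ y l → (y ⊞ conℤ (+ 4) ⊠ l ⊞ conℤ (+ 1)) ⊠ (y ⊞ conℤ (+ 4) ⊠ l ⊞ conℤ (+ 1)) ⊞ conℤ (+ 3) ⊠ (y ⊠ y)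
          ≗′ conℤ (+ 1) ⊞ conℤ (+ 2) ⊠ ((y ⊞ l) ⊠ (conℤ (+ 1) ⊞ conℤ (+ 2) ⊠ (y ⊞ l)))
             ⊞ conℤ (+ 6) ⊠ (l ⊠ (conℤ (+ 1) ⊞ conℤ (+ 2) ⊠ l))) refl y l ⟩
    + 1 ℤ.+ + 2 ℤ.* ((y ℤ.+ l) ℤ.* (+ 1 ℤ.+ + 2 ℤ.* (y ℤ.+ l))) ℤ.+ + 6 ℤ.* (l ℤ.* (+ 1 ℤ.+ + 2 ℤ.* l))
      ≡⟨ cong₂ (λ i j → + 1 ℤ.+ + 2 ℤ.* i ℤ.+ + 6 ℤ.* j) (sym (+tri (y ℤ.+ l))) (sym (+tri l)) ⟩
    + 1 ℤ.+ + 2 ℤ.* + tri (y ℤ.+ l) ℤ.+ + 6 ℤ.* + tri l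
      ≡⟨ cong₂ (λ i j → + 1 ℤ.+ i ℤ.+ j) (sym (ℤ.pos-* 2 (tri (y ℤ.+ l)))) (sym (ℤ.pos-* 6 (tri l))) ⟩
    + (1 ℕ.+ 2 ℕ.* tri (y ℤ.+ l) ℕ.+ 6 ℕ.* tri l) ∎)
    where open ≡-Reasoning

  g-admˡ : ∀ y → Adm (g y)
  g-admˡ y l = Ord-weaken (ℕ.≤-trans (∣k∣≤tri l) (ℕ.≤-trans (ℕ.m≤n*m (tri l) 6)
    (ℕ.≤-trans (ℕ.m≤n+m (6 ℕ.* tri l) (1 ℕ.+ 2 ℕ.* tri (y ℤ.+ l))) (ℕ.≤-reflexive (sym (shear y l)))))) (Ord-^ x₀ (sq (m y l) ℕ.+ 3 ℕ.* sq y))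

  g-admʳ : ∀ l → Adm λ y → g y l
  g-admʳ l y = Ord-weaken (ℕ.≤-trans (∣k∣≤sq y) (ℕ.≤-trans (ℕ.m≤n*m (sq y) 3) (ℕ.m≤n+m (3 ℕ.* sq y) (sq (m y l)))))
    (Ord-^ x₀ (sq (m y l) ℕ.+ 3 ℕ.* sq y))

  G : ℤ → Series
  G y = ∑ (g y)

  G-adm : Adm G
  G-adm y = Ord-∑ λ l → g-admʳ l y

  -- For fixed l the sum over k is shifted by l, which turns k into y + l. Swapping then puts y
  -- outside, where it can be split modulo 4.
  ψψ-∑ : x · ψ (x ^ 2) · ψ (x ^ 6) ≋ ∑ G
  ψψ-∑ = ≋-trans (≋-sym (∑-·ˡ (x · ψ (x ^ 2)) (Adm-^ (Ord-weaken (ℕ.s≤s ℕ.z≤n) (Ord-^ x₀ 6)) tri ∣k∣≤tri)))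
    (≋-trans (∑-cong inner) (≋-sym (∑-swap g g-admˡ g-admʳ)))
    where
    h : ℤ → ℤ → Series
    h l k = (x · (x ^ 6) ^ tri l) · (x ^ 2) ^ tri k
    base : Adm λ k → (x ^ 2) ^ tri k
    base = Adm-^ (Ord-weaken (ℕ.s≤s ℕ.z≤n) (Ord-^ x₀ 2)) tri ∣k∣≤tri
    h-g : ∀ l y → h l (y ℤ.+ l) ≋ g y l
    h-g l y = ≋-trans (·-cong (·-cong ≋-refl (^-assocʳ x 6 (tri l))) (^-assocʳ x 2 (tri (y ℤ.+ l))))
      (≋-trans (solve 3 (λ x a b → (x :* a) :* b := (x :* b) :* a) ≋-refl x (x ^ (6 ℕ.* tri l)) (x ^ (2 ℕ.* tri (y ℤ.+ l))))
        (≋-trans (≋-sym (^-homo-* x (1 ℕ.+ 2 ℕ.* tri (y ℤ.+ l)) (6 ℕ.* tri l))) (^-≡ x (sym (shear y l)))))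
    inner : ∀ l → (x · ψ (x ^ 2)) · (x ^ 6) ^ tri l ≋ ∑ λ y → g y l
    inner l = ≋-trans
      (solve 3 (λ x p a → (x :* p) :* a := (x :* a) :* p) ≋-refl x (ψ (x ^ 2)) ((x ^ 6) ^ tri l))
      (⟶-≋ (λ N → ≋-refl)
        (Box-resp (h-g l) (⟶-shift {h l} (Adm⇒Null (Adm-· (x · (x ^ 6) ^ tri l) base))
          (⟶-·ˡ (x · (x ^ 6) ^ tri l) (⟶-∑ base)) l))
        (⟶-∑ (g-admʳ l)))

  -- For fixed y the inner sum is x^(3y²) times a sum of x^(m²) over one class mod 4. `E` enumerates
  -- that class in a standard way, and `j` is the shift aligning the two enumerations.
  G-eval : ∀ {E a} y j → Adm E → ∑ E ≋ a → (∀ l → E (l ℤ.+ j) ≋ x ^ sq (m y l)) → G y ≋ B.e y · a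
  G-eval {E} {a} y j ad p r = ⟶-≋ (λ N → ≋-refl) (⟶-∑ (g-admˡ y))
    (Box-resp term (⟶-·ˡ (B.e y) (⟶-shift {E} (Adm⇒Null ad) (⟶-resp-lim p (⟶-∑ ad)) j)))
    where
    term : ∀ l → B.e y · E (l ℤ.+ j) ≋ g y l
    term l = ≋-trans (·-cong (≋-sym (^-*sq x 3 y)) (r l)) (≋-trans (SR.*-comm _ _) (≋-sym (^-homo-* x (sq (m y l)) (3 ℕ.* sq y))))

  x-≡ : ∀ {i j : ℤ} → i ≡ j → x ^ sq i ≋ x ^ sq j
  x-≡ refl = ≋-refl

  -- If y is even, then m is 1 or 3 mod 4, and either class sums to xψ(x⁸); collecting even y yields
  -- φ(x¹²). If y is 1 or 3 mod 4, the sum over y is x³ψ(x²⁴) both times, and m runs over 2 mod 4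
  -- and 0 mod 4, which together make φ(x⁴).
  ψψ-dissection : φ (x ^ 4) · (x ^ 3 · ψ ((x ^ 3) ^ 8)) +ˢ x · ψ (x ^ 8) · φ ((x ^ 3) ^ 4)
                  ≋ x · ψ (x ^ 2) · ψ (x ^ 6)
  ψψ-dissection = ≋-sym (≋-trans ψψ-∑ (≋-trans (∑-ev-od {G} G-adm)
    (≋-trans (+-cong (∑-ev-od {ev G} (Adm-ev {G} G-adm)) (∑-ev-od {od G} (Adm-od {G} G-adm)))
    (≋-trans (+-cong
        (+-cong (piece (ev (ev B.e)) β (Adm-ev {ev B.e} evB) r0)
                (piece (od (ev B.e)) β (Adm-od {ev B.e} evB) r2))
        (+-cong (piece (ev (od B.e)) α₂ (Adm-ev {od B.e} odB) r1)
                (piece (od (od B.e)) α₀ (Adm-od {od B.e} odB) r3)))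
    (≋-trans (solve 7 (λ p r b s t u v → (p :* b :+ r :* b) :+ (s :* u :+ t :* v) := (p :+ r) :* b :+ (s :* u :+ t :* v)) ≋-refl
        (∑ (ev (ev B.e))) (∑ (od (ev B.e))) β (∑ (ev (od B.e))) (∑ (od (od B.e))) α₂ α₀)
    (≋-trans (+-cong (·-cong (≋-sym (≋-trans (≋-sym B.∑-ev) (∑-ev-od {ev B.e} evB))) ≋-refl)
        (+-cong (·-cong B.∑-1mod4 ≋-refl) (·-cong B.∑-3mod4 ≋-refl)))
    (≋-trans (solve 5 (λ f b c u v → f :* b :+ (c :* u :+ c :* v) := (v :+ u) :* c :+ b :* f) ≋-refl
        (φ ((x ^ 3) ^ 4)) β (x ^ 3 · ψ ((x ^ 3) ^ 8)) α₂ α₀)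
      (+-cong (·-cong (≋-sym (≋-trans (≋-sym A.∑-ev) (∑-ev-od {ev A.e} evA))) ≋-refl) ≋-refl))))))))
    where
    β = x · ψ (x ^ 8)
    α₀ = ∑ (ev (ev A.e))
    α₂ = ∑ (od (ev A.e))
    evA = Adm-ev {A.e} A.e-adm
    odA = Adm-od {A.e} A.e-adm
    evB = Adm-ev {B.e} B.e-adm
    odB = Adm-od {B.e} B.e-adm
    piece : ∀ {H} E a → Adm E → (∀ k → H k ≋ E k · a) → ∑ H ≋ ∑ E · a
    piece E a ad r = ≋-trans (∑-cong r) (∑-·ʳ a ad)
    r0 : ∀ i → ev (ev G) i ≋ ev (ev B.e) i · β
    r0 i = G-eval {ev (od A.e)} (+ 2 ℤ.* (+ 2 ℤ.* i)) i (Adm-ev {od A.e} odA) A.∑-1mod4 λ l → x-≡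
      (solveℤ 2 (λ i l → conℤ (+ 1) ⊞ conℤ (+ 2) ⊠ (conℤ (+ 2) ⊠ (l ⊞ i)) ≗′ conℤ (+ 2) ⊠ (conℤ (+ 2) ⊠ i) ⊞ conℤ (+ 4) ⊠ l ⊞ conℤ (+ 1)) refl i l)
    r1 : ∀ i → ev (od G) i ≋ ev (od B.e) i · α₂
    r1 i = G-eval {od (ev A.e)} (+ 1 ℤ.+ + 2 ℤ.* (+ 2 ℤ.* i)) i (Adm-od {ev A.e} evA) ≋-refl λ l → x-≡
      (solveℤ 2 (λ i l → conℤ (+ 2) ⊠ (conℤ (+ 1) ⊞ conℤ (+ 2) ⊠ (l ⊞ i)) ≗′ conℤ (+ 1) ⊞ conℤ (+ 2) ⊠ (conℤ (+ 2) ⊠ i) ⊞ conℤ (+ 4) ⊠ l ⊞ conℤ (+ 1)) refl i l)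
    r2 : ∀ i → od (ev G) i ≋ od (ev B.e) i · β
    r2 i = G-eval {od (od A.e)} (+ 2 ℤ.* (+ 1 ℤ.+ + 2 ℤ.* i)) i (Adm-od {od A.e} odA) A.∑-3mod4 λ l → x-≡
      (solveℤ 2 (λ i l → conℤ (+ 1) ⊞ conℤ (+ 2) ⊠ (conℤ (+ 1) ⊞ conℤ (+ 2) ⊠ (l ⊞ i)) ≗′ conℤ (+ 2) ⊠ (conℤ (+ 1) ⊞ conℤ (+ 2) ⊠ i) ⊞ conℤ (+ 4) ⊠ l ⊞ conℤ (+ 1)) refl i l)
    r3 : ∀ i → od (od G) i ≋ od (od B.e) i · α₀
    -- Here y + 1 = 4(i + 1), and the carry makes the shift i + 1 in place of i.
    r3 i = G-eval {ev (ev A.e)} (+ 1 ℤ.+ + 2 ℤ.* (+ 1 ℤ.+ + 2 ℤ.* i)) (i ℤ.+ + 1) (Adm-ev {ev A.e} evA) ≋-refl λ l → x-≡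
      (solveℤ 2 (λ i l → conℤ (+ 2) ⊠ (conℤ (+ 2) ⊠ (l ⊞ (i ⊞ conℤ (+ 1)))) ≗′ conℤ (+ 1) ⊞ conℤ (+ 2) ⊠ (conℤ (+ 1) ⊞ conℤ (+ 2) ⊠ i) ⊞ conℤ (+ 4) ⊠ l ⊞ conℤ (+ 1)) refl i l)

-- Supports and inverses

-- Only exponents congruent to r mod d occur. The residue is an arbitrary integer representative, so
-- residues of products simply add.
record Supp (d r : ℤ) (a : Series) : Set where
  constructor supp
  field vanish : ∀ n → ¬ (d ∣ₛ + n ℤ.- r) → a n ≡ + 0
open Supp

Supp-resp : ∀ {d r a b} → a ≋ b → Supp d r a → Supp d r b
Supp-resp e p = supp λ n h → trans (sym (at e n)) (vanish p n h)

Supp-shift : ∀ {d r a} s → d ∣ₛ r ℤ.- s → Supp d r a → Supp d s a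
Supp-shift {d} {r} s e p = supp λ n h → vanish p n λ d∣n-r → h (subst (d ∣ₛ_)
  (solveℤ 3 (λ n r s → (n ⊞ (⊟ r)) ⊞ (r ⊞ (⊟ s)) ≗′ n ⊞ (⊟ s)) refl (+ n) r s)
  (Signed.∣m∣n⇒∣m+n d∣n-r e))

opaque
  unfolding _·_

  Supp-+ : ∀ {d r a b} → Supp d r a → Supp d r b → Supp d r (a +ˢ b)
  Supp-+ p s = supp λ n h → cong₂ ℤ._+_ (vanish p n h) (vanish s n h)

  Supp-neg : ∀ {d r a} → Supp d r a → Supp d r (-ˢ a)
  Supp-neg p = supp λ n h → cong ℤ.-_ (vanish p n h)

  Supp-const : ∀ {d} k → Supp d (+ 0) (const k)
  Supp-const k = supp λ { zero h → contradiction (divides (+ 0) refl) h ; (suc n) h → refl }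

  Supp-· : ∀ {d r s a b} → Supp d r a → Supp d s b → Supp d (r ℤ.+ s) (a · b)
  Supp-· {d} {r} {s} {a} {b} p t = supp λ n h → sumTo-zero (suc n) λ i i<1+n → term n h i (ℕ.≤-pred i<1+n)
    where
    term : ∀ n → ¬ (d ∣ₛ + n ℤ.- (r ℤ.+ s)) → ∀ i → i ℕ.≤ n → a i ℤ.* b (n ℕ.∸ i) ≡ + 0
    term n h i i≤n with d ∣ₛ? (+ i ℤ.- r)
    ... | no  i∤ = cong (ℤ._* b (n ℕ.∸ i)) (vanish p i i∤)
    ... | yes i∣ = trans (cong (a i ℤ.*_) (vanish t (n ℕ.∸ i) λ j∣ → h (subst (d ∣ₛ_)
        (trans (solveℤ 4 (λ i j r s → (i ⊞ (⊟ r)) ⊞ (j ⊞ (⊟ s)) ≗′ (i ⊞ j) ⊞ (⊟ (r ⊞ s))) refl (+ i) (+ (n ℕ.∸ i)) r s)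
          (cong (λ j → + j ℤ.- (r ℤ.+ s)) (ℕ.m+[n∸m]≡n i≤n)))
        (Signed.∣m∣n⇒∣m+n i∣ j∣)))) (ℤ.*-zeroʳ (a i))

Supp-⟶ : ∀ {d r u a} → (∀ N → Supp d r (u N)) → u ⟶ a → Supp d r a
Supp-⟶ p t = supp λ n h → let (N , hN) = eventually t n in
  trans (sym (upto (hN N ℕ.≤-refl) n ℕ.≤-refl)) (vanish (p N) n h)

module _ {d : ℤ} {x : Series} (s : Supp d (+ 0) x) where

  Supp-^ : ∀ k → Supp d (+ 0) (x ^ k)
  Supp-^ zero    = Supp-const (+ 1)
  Supp-^ (suc k) = Supp-· s (Supp-^ k)

  module _ (x₀ : Ord 1 x) where

    Supp-P : Supp d (+ 0) (P x)
    Supp-P = Supp-⟶ partial (⟶-P x₀)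
      where
      partial : ∀ N → Supp d (+ 0) (poch x x N)
      partial zero    = Supp-const (+ 1)
      partial (suc N) = Supp-· (partial N) (Supp-+ (Supp-const (+ 1)) (Supp-neg (Supp-^ (suc N))))

    Supp-∑ : (e : ℤ → ℕ) → (∀ k → ℤ.∣ k ∣ ℕ.≤ e k) → Supp d (+ 0) (∑ λ k → x ^ e k)
    Supp-∑ e le = Supp-⟶ partial (⟶-∑ (Adm-^ x₀ e le))
      where
      partial : ∀ N → Supp d (+ 0) (Box (λ k → x ^ e k) N)
      partial zero    = Supp-^ (e (+ 0))
      partial (suc N) = Supp-+ (partial N) (Supp-+ (Supp-^ (e (+ suc N))) (Supp-^ (e -[1+ N ])))

proj : ℤ → ℤ → Series → Series
proj d r a n with d ∣ₛ? (+ n ℤ.- r)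
... | yes _ = a n
... | no  _ = + 0

module _ (d r : ℤ) where

  proj-at : ∀ a n → d ∣ₛ + n ℤ.- r → proj d r a n ≡ a n
  proj-at a n d∣ with d ∣ₛ? (+ n ℤ.- r)
  ... | yes _ = refl
  ... | no d∤ = contradiction d∣ d∤

  proj-vanish : ∀ a n → ¬ (d ∣ₛ + n ℤ.- r) → proj d r a n ≡ + 0
  proj-vanish a n d∤ with d ∣ₛ? (+ n ℤ.- r)
  ... | yes d∣ = contradiction d∣ d∤
  ... | no  _  = refl

  proj-cong : ∀ {a b} → a ≋ b → proj d r a ≋ proj d r b
  proj-cong {a} {b} e = mk≋ term
    where
    term : ∀ n → proj d r a n ≡ proj d r b n
    term n with d ∣ₛ? (+ n ℤ.- r)
    ... | yes _ = at e n
    ... | no  _ = refl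

  Supp-proj : ∀ a → Supp d r (proj d r a)
  Supp-proj a = supp (proj-vanish a)

  proj-Supp : ∀ {a} → Supp d r a → proj d r a ≋ a
  proj-Supp {a} p = mk≋ term
    where
    term : ∀ n → proj d r a n ≡ a n
    term n with d ∣ₛ? (+ n ℤ.- r)
    ... | yes _ = refl
    ... | no d∤ = sym (vanish p n d∤)

  opaque
    unfolding _·_

    proj-+ : ∀ a b → proj d r (a +ˢ b) ≋ proj d r a +ˢ proj d r b
    proj-+ a b = mk≋ term
      where
      term : ∀ n → proj d r (a +ˢ b) n ≡ proj d r a n ℤ.+ proj d r b n
      term n with d ∣ₛ? (+ n ℤ.- r)
      ... | yes _ = refl
      ... | no  _ = refl

    -- A factor in q^d moves exponents by multiples of d, so it respects residue classes.
    proj-· : ∀ a {b} → Supp d (+ 0) b → proj d r (a · b) ≋ proj d r a · b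
    proj-· a {b} p = mk≋ coefficient
      where
      term : ∀ n → d ∣ₛ + n ℤ.- r → ∀ i → i ℕ.≤ n → a i ℤ.* b (n ℕ.∸ i) ≡ proj d r a i ℤ.* b (n ℕ.∸ i)
      term n n∣ i i≤n with d ∣ₛ? (+ (n ℕ.∸ i) ℤ.- + 0)
      ... | no  j∤ = trans (trans (cong (a i ℤ.*_) (vanish p (n ℕ.∸ i) j∤)) (ℤ.*-zeroʳ (a i)))
              (sym (trans (cong (proj d r a i ℤ.*_) (vanish p (n ℕ.∸ i) j∤)) (ℤ.*-zeroʳ (proj d r a i))))
      ... | yes j∣ = cong (ℤ._* b (n ℕ.∸ i)) (sym (proj-at a i (subst (d ∣ₛ_)
              (trans (cong (λ m → (+ m ℤ.- r) ℤ.- (+ (n ℕ.∸ i) ℤ.- + 0)) (sym (ℕ.m+[n∸m]≡n i≤n)))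
                (solveℤ 3 (λ i j r → ((i ⊞ j) ⊞ (⊟ r)) ⊞ (⊟ (j ⊞ (⊟ conℤ (+ 0)))) ≗′ i ⊞ (⊟ r)) refl (+ i) (+ (n ℕ.∸ i)) r))
              (Signed.∣m∣n⇒∣m-n n∣ j∣))))
      coefficient : ∀ n → proj d r (a · b) n ≡ (proj d r a · b) n
      coefficient n = byCases (d ∣ₛ? (+ n ℤ.- r))
        where
        byCases : Dec (d ∣ₛ + n ℤ.- r) → proj d r (a · b) n ≡ (proj d r a · b) n
        byCases (yes n∣) = trans (proj-at (a · b) n n∣) (sumTo-cong (suc n) λ i i<1+n → term n n∣ i (ℕ.≤-pred i<1+n))
        byCases (no  n∤) = trans (proj-vanish (a · b) n n∤) (sym (vanish (Supp-· (Supp-proj a) p) n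
          λ d∣ → n∤ (subst (λ s → d ∣ₛ + n ℤ.- s) (ℤ.+-identityʳ r) d∣)))

  proj-disjoint : ∀ {s a} → ¬ (d ∣ₛ r ℤ.- s) → Supp d s a → proj d r a ≋ const (+ 0)
  proj-disjoint {s} {a} r∤s p = mk≋ λ n → trans (term n) (sym (const-0 n))
    where
    term : ∀ n → proj d r a n ≡ + 0
    term n with d ∣ₛ? (+ n ℤ.- r)
    ... | no  _  = refl
    ... | yes n∣ = vanish p n λ n∣s → r∤s (subst (d ∣ₛ_)
      (solveℤ 3 (λ n r s → (n ⊞ (⊟ s)) ⊞ (⊟ (n ⊞ (⊟ r))) ≗′ r ⊞ (⊟ s)) refl (+ n) r s)
      (Signed.∣m∣n⇒∣m-n n∣s n∣))

module _ (a : Series) where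

  invPrefix-last : ∀ n → invPrefix a (suc n) (suc n) ≡
                   ℤ.- sumTo (suc n) (λ j → a (suc j) ℤ.* invPrefix a n (n ℕ.∸ j))
  invPrefix-last n with suc n ℕ.≟ suc n
  ... | yes _ = refl
  ... | no ≢  = contradiction refl ≢

  invPrefix-step : ∀ n i → i ℕ.≤ n → invPrefix a (suc n) i ≡ invPrefix a n i
  invPrefix-step n i i≤n with i ℕ.≟ suc n
  ... | yes refl = contradiction i≤n (ℕ.<-irrefl refl)
  ... | no  _    = refl

  invPrefix-stable : ∀ n i → i ℕ.≤ n → invPrefix a n i ≡ inv a i
  invPrefix-stable n i i≤n with ℕ.m≤n⇒m<n∨m≡n i≤n
  invPrefix-stable n       i i≤n | inj₂ refl = refl
  invPrefix-stable (suc n) i i≤n | inj₁ i<1+n =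
    trans (invPrefix-step n i (ℕ.≤-pred i<1+n)) (invPrefix-stable n i (ℕ.≤-pred i<1+n))

  inv-suc : ∀ n → inv a (suc n) ≡ ℤ.- (tail a ⊛ inv a) n
  inv-suc n = trans (invPrefix-last n) (cong ℤ.-_ (sumTo-cong (suc n) λ j _ →
    cong (a (suc j) ℤ.*_) (invPrefix-stable n (n ℕ.∸ j) (ℕ.m∸n≤m n j))))

  inv-inverse : a 0 ≡ + 1 → a · inv a ≋ const (+ 1)
  inv-inverse a₀ = ≋-trans (·-⊛ a (inv a)) (≋-trans (mk≋ coefficient) one-const)
    where
    coefficient : ∀ n → (a ⊛ inv a) n ≡ one n
    coefficient zero    = trans (⊛-zero a (inv a)) (trans (ℤ.*-identityʳ (a 0)) a₀)
    coefficient (suc n) = trans (⊛-suc a (inv a) n) (trans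
      (cong (λ t → t ℤ.* inv a (suc n) ℤ.+ (tail a ⊛ inv a) n) a₀)
      (trans (cong (λ t → + 1 ℤ.* t ℤ.+ (tail a ⊛ inv a) n) (inv-suc n))
        (solveℤ 1 (λ t → conℤ (+ 1) ⊠ (⊟ t) ⊞ t ≗′ conℤ (+ 0)) refl ((tail a ⊛ inv a) n))))

cancel≋ : ∀ {a b u v} → u · v ≋ const (+ 1) → a · u ≋ b · u → a ≋ b
cancel≋ {a} {b} {u} {v} uv e = ≋-trans (≋-sym (cancel a)) (≋-trans (·-cong e ≋-refl) (cancel b))
  where
  cancel : ∀ a → a · u · v ≋ a
  cancel a = ≋-trans (SR.*-assoc a u v) (≋-trans (·-cong ≋-refl uv) (solve 1 (λ a → a :* con (+ 1) := a) ≋-refl a))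

cancel≈ : ∀ {M a b u v} → u · v ≋ const (+ 1) → a · u ≈[ M ] b · u → a ≈[ M ] b
cancel≈ {M} {a} {b} {u} {v} uv e = ≈-trans (≋⇒≈ M (≋-sym (cancel a))) (≈-trans (≈-· e ≈-refl) (≋⇒≈ M (cancel b)))
  where
  cancel : ∀ a → a · u · v ≋ a
  cancel a = ≋-trans (SR.*-assoc a u v) (≋-trans (·-cong ≋-refl uv) (solve 1 (λ a → a :* con (+ 1) := a) ≋-refl a))

-- The projection of b to exponents divisible by d is again an inverse of a, because projecting
-- commutes with multiplication by a and fixes 1. Inverses are unique.
Supp-inverse : ∀ {d a b} → a · b ≋ const (+ 1) → Supp d (+ 0) a → Supp d (+ 0) b
Supp-inverse {d} {a} {b} ab s = Supp-resp
  (cancel≋ ab (≋-trans (≋-sym (proj-· d (+ 0) b s)) (≋-trans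
    (proj-cong d (+ 0) (≋-trans (SR.*-comm b a) ab))
    (≋-trans (proj-Supp d (+ 0) (Supp-const (+ 1))) (≋-sym (≋-trans (SR.*-comm b a) ab))))))
  (Supp-proj d (+ 0) b)

-- The variable q and the products f_k

q : Series
q zero          = + 0
q (suc zero)    = + 1
q (suc (suc _)) = + 0

q₀ : Ord 1 q
q₀ = ord λ { zero _ → refl ; (suc _) (ℕ.s≤s ()) }

q^₀ : ∀ k → Ord 1 (q ^ suc k)
q^₀ k = Ord-weaken (ℕ.s≤s ℕ.z≤n) (Ord-^ q₀ (suc k))

q·-zero : ∀ a → (q · a) 0 ≡ + 0
q·-zero a = trans (at (·-⊛ q a) 0) (⊛-zero q a)

q·-suc : ∀ a n → (q · a) (suc n) ≡ a n
q·-suc a n = trans (at (·-⊛ q a) (suc n)) (trans (⊛-suc q a n) (trans (ℤ.+-identityˡ _)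
  (trans (⊛-cong≤ n {b = a} (λ i _ → trans (tail-q i) (at one-const i)) (λ _ _ → refl))
    (trans (const-⊛ (+ 1) a n) (ℤ.*-identityˡ (a n))))))
  where
  tail-q : ∀ i → tail q i ≡ one i
  tail-q zero    = refl
  tail-q (suc i) = refl

q^-diagonal : ∀ d → (q ^ d) d ≡ + 1
q^-diagonal zero    = const-zero (+ 1)
q^-diagonal (suc d) = trans (q·-suc (q ^ d) d) (q^-diagonal d)

q^-off : ∀ d n → n ≢ d → (q ^ d) n ≡ + 0
q^-off zero    zero    n≢d = contradiction refl n≢d
q^-off zero    (suc n) n≢d = const-suc (+ 1) n
q^-off (suc d) zero    n≢d = q·-zero (q ^ d)
q^-off (suc d) (suc n) n≢d = trans (q·-suc (q ^ d) n) (q^-off d n λ n≡d → n≢d (cong suc n≡d))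

Supp-q^ : ∀ d k → Supp d (+ k) (q ^ k)
Supp-q^ d k = supp λ n h → q^-off k n λ { refl → h (divides (+ 0) (trans (ℤ.+-inverseʳ (+ k)) refl)) }

-- The series q is no unit, so `cancel≈` does not apply; the quotient is shifted down instead.
q-cancel≈ : ∀ {M a b} → q · a ≈[ M ] q · b → a ≈[ M ] b
q-cancel≈ {M} {a} {b} (mod c e) = mod (tail c) (mk≋ λ n → trans (sym (q·-suc a n)) (trans (at e (suc n))
  (trans (+ˢ-at (q · b) _ (suc n)) (trans (cong₂ ℤ._+_ (q·-suc b n)
    (trans (const-· M c (suc n)) (sym (const-· M (tail c) n)))) (sym (+ˢ-at b _ n))))))

oneMinusQ^≋ : ∀ d → oneMinusQ^ (suc d) ≋ const (+ 1) +ˢ -ˢ (q ^ suc d)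
oneMinusQ^≋ d = mk≋ λ n → trans (coefficient n) (sym (trans (+ˢ-at _ _ n) (cong (λ t → const (+ 1) n ℤ.+ t) (-ˢ-at (q ^ suc d) n))))
  where
  coefficient : ∀ n → oneMinusQ^ (suc d) n ≡ const (+ 1) n ℤ.+ ℤ.- (q ^ suc d) n
  coefficient n with n ℕ.≟ 0 | n ℕ.≟ suc d
  ... | yes refl | _ = sym (cong₂ (λ i j → i ℤ.+ ℤ.- j) (const-zero (+ 1)) (q·-zero (q ^ d)))
  ... | no n≢0 | yes refl = sym (cong₂ (λ i j → i ℤ.+ ℤ.- j) (const-suc (+ 1) d) (q^-diagonal (suc d)))
  ... | no n≢0 | no n≢d = sym (cong₂ (λ i j → i ℤ.+ ℤ.- j) (const-nonzero n n≢0) (q^-off (suc d) n n≢d))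
    where
    const-nonzero : ∀ n → n ≢ 0 → const (+ 1) n ≡ + 0
    const-nonzero zero    n≢0 = contradiction refl n≢0
    const-nonzero (suc n) n≢0 = const-suc (+ 1) n

F : ℕ → Series
F k = P (q ^ k)

f≋F : ∀ m → f (suc m) ≋ F (suc m)
f≋F m = mk≋ λ n → at (partial n) n
  where
  partial : ∀ N → partialEta (suc m) N ≋ poch (q ^ suc m) (q ^ suc m) N
  partial zero    = one-const
  partial (suc N) = ≋-trans (≋-sym (·-⊛ _ _)) (≋-trans (·-cong
      (≋-trans (oneMinusQ^≋ (N ℕ.+ m ℕ.* suc N))
        (+-cong ≋-refl (SR.-‿cong (≋-sym (^-assocʳ q (suc m) (suc N)))))) (partial N))
    (SR.*-comm _ _))

^ₛ≋^ : ∀ {a b} → a ≋ b → ∀ k → a ^ₛ k ≋ b ^ k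
^ₛ≋^ e zero    = one-const
^ₛ≋^ {a} e (suc k) = ≋-trans (≋-sym (·-⊛ a (a ^ₛ k))) (·-cong e (^ₛ≋^ e k))

F-inverse : ∀ k → F k · inv (F k) ≋ const (+ 1)
F-inverse k = inv-inverse (F k) (const-zero (+ 1))

CP3-equation : CP3 · (F 1 ^ 2 · F 2 ^ 2) ≋ F 3 ^ 6 · F 6 ^ 6
CP3-equation = ≋-trans (·-cong (≋-sym (·-⊛ numerator (inv denominator))) (≋-sym den))
  (≋-trans (solve 3 (λ n v d → n :* v :* d := n :* (d :* v)) ≋-refl numerator (inv denominator) denominator)
    (≋-trans (·-cong num (inv-inverse denominator refl))
      (solve 1 (λ n → n :* con (+ 1) := n) ≋-refl (F 3 ^ 6 · F 6 ^ 6))))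
  where
  den : denominator ≋ F 1 ^ 2 · F 2 ^ 2
  den = ≋-trans (≋-sym (·-⊛ (f 1 ^ₛ 2) (f 2 ^ₛ 2))) (·-cong (^ₛ≋^ (f≋F 0) 2) (^ₛ≋^ (f≋F 1) 2))
  num : numerator ≋ F 3 ^ 6 · F 6 ^ 6
  num = ≋-trans (≋-sym (·-⊛ (f 3 ^ₛ 6) (f 6 ^ₛ 6))) (·-cong (^ₛ≋^ (f≋F 2) 6) (^ₛ≋^ (f≋F 5) 6))

-- The odd part of CP₃

≈-setoid : ℤ → Setoid _ _
≈-setoid M = record { _≈_ = λ a b → a ≈[ M ] b
  ; isEquivalence = record { refl = ≈-refl ; sym = ≈-sym ; trans = ≈-trans } }

unit-^ : ∀ {u v} k → u · v ≋ const (+ 1) → u ^ k · v ^ k ≋ const (+ 1)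
unit-^ zero    e = solve 0 (con (+ 1) :* con (+ 1) := con (+ 1)) ≋-refl
unit-^ {u} {v} (suc k) e = ≋-trans
  (solve 4 (λ u v a b → (u :* a) :* (v :* b) := (u :* v) :* (a :* b)) ≋-refl u v (u ^ k) (v ^ k))
  (≋-trans (·-cong e (unit-^ k e)) (solve 0 (con (+ 1) :* con (+ 1) := con (+ 1)) ≋-refl))

≈-drop : ∀ M {a} b → a +ˢ const M · b ≈[ M ] a
≈-drop M b = mod b ≋-refl

ψ-F : ∀ k → ψ (q ^ suc k) · F (suc k) ≋ F (suc k ℕ.+ suc k) ^ 2
ψ-F k = ≋-trans (ψ-product (q^₀ k)) (^-congˡ 2 (P-cong (Ord-·ʳ (q ^ suc k) (q^₀ k)) (≋-sym (^-homo-* q (suc k) (suc k)))))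

φ⁻-F : ∀ k → φ (-ˢ (q ^ suc k)) · F (suc k ℕ.+ suc k) ≋ F (suc k) ^ 2
φ⁻-F k = ≋-trans (·-cong ≋-refl (≋-sym (P-cong (Ord-·ʳ (q ^ suc k) (q^₀ k)) (≋-sym (^-homo-* q (suc k) (suc k))))))
  (φ-product (q^₀ k))

φφ⁻-F : ∀ k → let d = suc k ℕ.+ suc k in
        φ (q ^ suc k) · φ (-ˢ (q ^ suc k)) · F (d ℕ.+ d) ^ 2 ≋ F d ^ 4
φφ⁻-F k = cancel≋ (unit-^ 2 (F-inverse d)) (≋-trans
  (·-cong (·-cong ≋-refl (^-congˡ 2 (≋-sym (P-cong xxxx₀ x⁴)))) (^-congˡ 2 (≋-sym (P-cong xx₀ xx))))
  (≋-trans (φφ-product (q^₀ k)) (≋-trans (^-congˡ 6 (P-cong xx₀ xx))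
    (solve 1 (λ y → y :^ 6 := y :^ 4 :* y :^ 2) ≋-refl (F d)))))
  where
  d = suc k ℕ.+ suc k
  x = q ^ suc k
  xx₀ = Ord-·ʳ x (q^₀ k)
  xxxx₀ = Ord-·ʳ (x · x) xx₀
  xx : x · x ≋ q ^ d
  xx = ≋-sym (^-homo-* q (suc k) (suc k))
  x⁴ : (x · x) · (x · x) ≋ q ^ (d ℕ.+ d)
  x⁴ = ≋-trans (·-cong xx xx) (≋-sym (^-homo-* q d d))

F-square-mod2 : ∀ k → F (suc k) ^ 2 ≈[ + 2 ] F (suc k ℕ.+ suc k)
F-square-mod2 k = ≈-trans (P-square-mod2 (q^₀ k))
  (≋⇒≈ (+ 2) (P-cong (Ord-·ʳ (q ^ suc k) (q^₀ k)) (≋-sym (^-homo-* q (suc k) (suc k)))))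

F-fourth-mod2 : ∀ k → let d = suc k ℕ.+ suc k in F (suc k) ^ 4 ≈[ + 2 ] F (d ℕ.+ d)
F-fourth-mod2 k = ≈-trans (≋⇒≈ (+ 2) (solve 1 (λ a → a :^ 4 := (a :^ 2) :^ 2) ≋-refl (F (suc k))))
  (≈-trans (≈-^ 2 (F-square-mod2 k)) (F-square-mod2 (k ℕ.+ suc k)))

-- Each squaring doubles the modulus: f_k² ≡ f_2k mod 2 is squared twice.
F-eighth-mod8 : ∀ k → F (suc k) ^ 8 ≈[ + 8 ] F (suc k ℕ.+ suc k) ^ 4
F-eighth-mod8 k = ≈-trans (≋⇒≈ (+ 8) (solve 1 (λ a → a :^ 8 := ((a :^ 2) :^ 2) :^ 2) ≋-refl (F (suc k))))
  (≈-trans (≈-square (+ 2) (≈-square (+ 1) (F-square-mod2 k)))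
    (≋⇒≈ (+ 8) (solve 1 (λ a → (a :^ 2) :^ 2 := a :^ 4) ≋-refl (F (suc k ℕ.+ suc k)))))

-- Modulo 2, Gauss's product reads ψ(q^k) f_k = f_2k² ≡ f_k⁴.
ψ-mod2 : ∀ k → ψ (q ^ suc k) ≈[ + 2 ] F (suc k) ^ 3
ψ-mod2 k = cancel≈ (F-inverse (suc k)) (≈-trans (≋⇒≈ (+ 2) (ψ-F k))
  (≈-trans (≈-^ 2 (≈-sym (F-square-mod2 k)))
    (≋⇒≈ (+ 2) (solve 1 (λ a → (a :^ 2) :^ 2 := a :^ 3 :* a) ≋-refl (F (suc k))))))

φ-split-q : ∀ k → φ (q ^ suc k) ≋ φ (q ^ (suc k ℕ.* 4)) +ˢ const (+ 2) · (q ^ suc k · ψ (q ^ (suc k ℕ.* 8)))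
φ-split-q k = ≋-trans (Gauss.φ-split (q^₀ k)) (+-cong (φ-cong (^-assocʳ q (suc k) 4))
  (·-cong ≋-refl (·-cong ≋-refl (ψ-cong (^-assocʳ q (suc k) 8)))))

φ⁻-split-q : ∀ k → φ (-ˢ (q ^ suc k)) ≋ φ (q ^ (suc k ℕ.* 4)) +ˢ -ˢ (const (+ 2) · (q ^ suc k · ψ (q ^ (suc k ℕ.* 8))))
φ⁻-split-q k = ≋-trans (Gauss.φ-split (Ord-neg (q^₀ k))) (≋-trans
  (+-cong (φ-cong (≋-trans (solve 1 (λ x → (:- x) :^ 4 := x :^ 4) ≋-refl (q ^ suc k)) (^-assocʳ q (suc k) 4)))
    (·-cong ≋-refl (·-cong ≋-refl (ψ-cong (≋-trans (solve 1 (λ x → (:- x) :^ 8 := x :^ 8) ≋-refl (q ^ suc k)) (^-assocʳ q (suc k) 8))))))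
  (solve 3 (λ a x p → a :+ con (+ 2) :* ((:- x) :* p) := a :+ :- (con (+ 2) :* (x :* p))) ≋-refl
    (φ (q ^ (suc k ℕ.* 4))) (q ^ suc k) (ψ (q ^ (suc k ℕ.* 8)))))

-- The 2-dissection of φ(q^j) is a_j + 2 b_j, and `L` is half of the odd part of φ(q) φ(q³).
a₁ a₃ a₆ b₁ b₃ b₆ L : Series
a₁ = φ (q ^ 4)
a₃ = φ (q ^ 12)
a₆ = φ (q ^ 24)
b₁ = q ^ 1 · ψ (q ^ 8)
b₃ = q ^ 3 · ψ (q ^ 24)
b₆ = q ^ 6 · ψ (q ^ 48)
L = a₁ · b₃ +ˢ b₁ · a₃

L-ψψ : L ≋ q ^ 1 · ψ (q ^ 2) · ψ (q ^ 6)
L-ψψ = ≋-trans (≋-sym (+-cong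
    (·-cong (φ-cong (^-assocʳ q 1 4)) (·-cong (^-assocʳ q 1 3)
      (ψ-cong (≋-trans (^-assocʳ (q ^ 1) 3 8) (^-assocʳ q 1 24)))))
    (·-cong (·-cong ≋-refl (ψ-cong (^-assocʳ q 1 8)))
      (φ-cong (≋-trans (^-assocʳ (q ^ 1) 3 4) (^-assocʳ q 1 12))))))
  (≋-trans (Lattice.ψψ-dissection (q^₀ 0))
    (·-cong (·-cong ≋-refl (ψ-cong (^-assocʳ q 1 2))) (ψ-cong (^-assocʳ q 1 6))))

K : Series
K = F 6 ^ 5 · F 4 ^ 2 · F 12 ^ 2

-- The φ(-q) in f₁² = φ(-q) f₂ is completed to φ(q) φ(-q) f₄² = f₂⁴, which leaves φ(q). The
-- auxiliary f₆⁴ = φ(q³) φ(-q³) f₁₂² does two things: it raises the cube of φ(-q³) coming from f₃⁶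
-- to a fourth power, which is 1 modulo 8, and it supplies the φ(q³) that pairs with φ(q) to produce
-- `L`.
CP3-theta : CP3 · F 2 ^ 7 ≋ φ (-ˢ (q ^ 3)) ^ 4 · φ (q ^ 1) · φ (q ^ 3) · K
CP3-theta = cancel≋ (unit-^ 4 (F-inverse 6)) (begin
  c · F 2 ^ 7 · F 6 ^ 4
    ≈⟨ solve 3 (λ c x y → c :* x :^ 7 :* y := c :* x :^ 3 :* (x :^ 4 :* y)) ≋-refl c (F 2) (F 6 ^ 4) ⟩
  c · F 2 ^ 3 · (F 2 ^ 4 · F 6 ^ 4)
    ≈⟨ ·-cong ≋-refl (≋-sym (·-cong (φφ⁻-F 0) (φφ⁻-F 2))) ⟩
  c · F 2 ^ 3 · ((p₁ · m₁ · F 4 ^ 2) · (p₃ · m₃ · F 12 ^ 2))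
    ≈⟨ solve 8 (λ c f₂ p₁ m₁ f₄ p₃ m₃ f₁₂ → c :* f₂ :^ 3 :* ((p₁ :* m₁ :* f₄ :^ 2) :* (p₃ :* m₃ :* f₁₂ :^ 2))
         := c :* ((m₁ :* f₂) :* f₂ :^ 2) :* (p₁ :* f₄ :^ 2 :* p₃ :* m₃ :* f₁₂ :^ 2)) ≋-refl
         c (F 2) p₁ m₁ (F 4) p₃ m₃ (F 12) ⟩
  c · ((m₁ · F 2) · F 2 ^ 2) · G
    ≈⟨ ·-cong (≋-trans (·-cong ≋-refl (·-cong (φ⁻-F 0) ≋-refl)) CP3-equation) ≋-refl ⟩
  F 3 ^ 6 · F 6 ^ 6 · G
    ≈⟨ solve 3 (λ x y g → x :^ 6 :* y :* g := (x :^ 2) :^ 3 :* y :* g) ≋-refl (F 3) (F 6 ^ 6) G ⟩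
  (F 3 ^ 2) ^ 3 · F 6 ^ 6 · G
    ≈⟨ ·-cong (·-cong (^-congˡ 3 (≋-sym (φ⁻-F 2))) ≋-refl) ≋-refl ⟩
  (m₃ · F 6) ^ 3 · F 6 ^ 6 · G
    ≈⟨ solve 6 (λ p₁ f₄ p₃ m₃ f₁₂ f₆ → (m₃ :* f₆) :^ 3 :* f₆ :^ 6 :* (p₁ :* f₄ :^ 2 :* p₃ :* m₃ :* f₁₂ :^ 2)
         := m₃ :^ 4 :* p₁ :* p₃ :* (f₆ :^ 5 :* f₄ :^ 2 :* f₁₂ :^ 2) :* f₆ :^ 4) ≋-refl
         p₁ (F 4) p₃ m₃ (F 12) (F 6) ⟩
  m₃ ^ 4 · p₁ · p₃ · K · F 6 ^ 4 ∎)
  where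
  open ≋-Reasoning
  c = CP3
  p₁ = φ (q ^ 1)
  p₃ = φ (q ^ 3)
  m₁ = φ (-ˢ (q ^ 1))
  m₃ = φ (-ˢ (q ^ 3))
  G = p₁ · F 4 ^ 2 · p₃ · m₃ · F 12 ^ 2

module _ {d : ℤ} (k : ℕ) (d∣k : d ∣ₛ + suc k) where

  private
    Supp-q : Supp d (+ 0) (q ^ suc k)
    Supp-q = Supp-shift (+ 0) (subst (d ∣ₛ_) (sym (ℤ.+-identityʳ (+ suc k))) d∣k) (Supp-q^ d (suc k))

  Supp-F : Supp d (+ 0) (F (suc k))
  Supp-F = Supp-P Supp-q (q^₀ k)

  Supp-φ : Supp d (+ 0) (φ (q ^ suc k))
  Supp-φ = Supp-∑ Supp-q (q^₀ k) sq ∣k∣≤sq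

  Supp-ψ : Supp d (+ 0) (ψ (q ^ suc k))
  Supp-ψ = Supp-∑ Supp-q (q^₀ k) tri ∣k∣≤tri

-- Parity splittings φ(-q³)⁴ = U - 8V and φ(q) φ(q³) = W + 2L, with U, W even and V, L odd in q;
-- `Ev` and `Od` are the two parts of their product.
U V W Ev Od : Series
U = a₃ ^ 4 +ˢ const (+ 8) · (const (+ 3) · a₃ ^ 2 · (b₃ · b₃) +ˢ const (+ 2) · ((b₃ · b₃) · (b₃ · b₃)))
V = a₃ · b₃ · (a₃ ^ 2 +ˢ const (+ 4) · (b₃ · b₃))
W = a₁ · a₃ +ˢ const (+ 4) · (b₁ · b₃)
Ev = U · W +ˢ -ˢ (const (+ 16) · (V · L))
Od = const (+ 2) · (U · L) +ˢ -ˢ (const (+ 8) · (V · W))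

theta-parts : φ (-ˢ (q ^ 3)) ^ 4 · φ (q ^ 1) · φ (q ^ 3) ≋ Ev +ˢ Od
theta-parts = ≋-trans (·-cong (·-cong (^-congˡ 4 (φ⁻-split-q 2)) (φ-split-q 0)) (φ-split-q 2))
  (solve 4 (λ a₁ b₁ a₃ b₃ →
    let u = a₃ :^ 4 :+ con (+ 8) :* (con (+ 3) :* a₃ :^ 2 :* (b₃ :* b₃) :+ con (+ 2) :* ((b₃ :* b₃) :* (b₃ :* b₃)))
        v = a₃ :* b₃ :* (a₃ :^ 2 :+ con (+ 4) :* (b₃ :* b₃))
        w = a₁ :* a₃ :+ con (+ 4) :* (b₁ :* b₃)
        l = a₁ :* b₃ :+ b₁ :* a₃
    in (a₃ :+ :- (con (+ 2) :* b₃)) :^ 4 :* (a₁ :+ con (+ 2) :* b₁) :* (a₃ :+ con (+ 2) :* b₃)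
       := (u :* w :+ :- (con (+ 16) :* (v :* l))) :+ (con (+ 2) :* (u :* l) :+ :- (con (+ 8) :* (v :* w))))
    ≋-refl a₁ b₁ a₃ b₃)

a₁-even : Supp (+ 2) (+ 0) a₁
a₁-even = Supp-φ 3 (from-yes (+ 2 ∣ₛ? + 4))

a₃-even : Supp (+ 2) (+ 0) a₃
a₃-even = Supp-φ 11 (from-yes (+ 2 ∣ₛ? + 12))

b₁-odd : Supp (+ 2) (+ 1) b₁
b₁-odd = Supp-· (Supp-q^ (+ 2) 1) (Supp-ψ 7 (from-yes (+ 2 ∣ₛ? + 8)))

b₃-odd : Supp (+ 2) (+ 1) b₃
b₃-odd = Supp-shift (+ 1) (from-yes (+ 2 ∣ₛ? + 2))
  (Supp-· (Supp-q^ (+ 2) 3) (Supp-ψ 23 (from-yes (+ 2 ∣ₛ? + 24))))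

odd·odd : ∀ {a b} → Supp (+ 2) (+ 1) a → Supp (+ 2) (+ 1) b → Supp (+ 2) (+ 0) (a · b)
odd·odd s t = Supp-shift (+ 0) (from-yes (+ 2 ∣ₛ? + 2)) (Supp-· s t)

U-even : Supp (+ 2) (+ 0) U
U-even = Supp-+ (Supp-^ a₃-even 4) (Supp-· (Supp-const (+ 8)) (Supp-+
  (Supp-· (Supp-· (Supp-const (+ 3)) (Supp-^ a₃-even 2)) b₃b₃)
  (Supp-· (Supp-const (+ 2)) (Supp-· b₃b₃ b₃b₃))))
  where b₃b₃ = odd·odd b₃-odd b₃-odd

V-odd : Supp (+ 2) (+ 1) V
V-odd = Supp-· (Supp-· a₃-even b₃-odd)
  (Supp-+ (Supp-^ a₃-even 2) (Supp-· (Supp-const (+ 4)) (odd·odd b₃-odd b₃-odd)))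

W-even : Supp (+ 2) (+ 0) W
W-even = Supp-+ (Supp-· a₁-even a₃-even) (Supp-· (Supp-const (+ 4)) (odd·odd b₁-odd b₃-odd))

L-odd : Supp (+ 2) (+ 1) L
L-odd = Supp-+ (Supp-· a₁-even b₃-odd) (Supp-· b₁-odd a₃-even)

Ev-even : Supp (+ 2) (+ 0) Ev
Ev-even = Supp-+ (Supp-· U-even W-even) (Supp-neg (Supp-· (Supp-const (+ 16)) (odd·odd V-odd L-odd)))

Od-odd : Supp (+ 2) (+ 1) Od
Od-odd = Supp-+ (Supp-· (Supp-const (+ 2)) (Supp-· U-even L-odd))
  (Supp-neg (Supp-· (Supp-const (+ 8)) (Supp-· V-odd W-even)))

CP3-odd : Series
CP3-odd = proj (+ 2) (+ 1) CP3

CP3-odd-theta : CP3-odd · F 2 ^ 7 ≋ Od · K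
CP3-odd-theta = begin
  CP3-odd · F 2 ^ 7              ≈⟨ ≋-sym (proj-· (+ 2) (+ 1) CP3 (Supp-^ (F-even 1 (from-yes (+ 2 ∣ₛ? + 2))) 7)) ⟩
  proj (+ 2) (+ 1) (CP3 · F 2 ^ 7)
    ≈⟨ proj-cong (+ 2) (+ 1) (≋-trans CP3-theta (≋-trans (·-cong theta-parts ≋-refl) (SR.distribʳ K Ev Od))) ⟩
  proj (+ 2) (+ 1) (Ev · K +ˢ Od · K)
    ≈⟨ proj-+ (+ 2) (+ 1) (Ev · K) (Od · K) ⟩
  proj (+ 2) (+ 1) (Ev · K) +ˢ proj (+ 2) (+ 1) (Od · K)
    ≈⟨ +-cong (proj-disjoint (+ 2) (+ 1) (from-no (+ 2 ∣ₛ? + 1)) (Supp-· Ev-even K-even))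
              (proj-Supp (+ 2) (+ 1) (Supp-· Od-odd K-even)) ⟩
  const (+ 0) +ˢ Od · K          ≈⟨ SR.+-identityˡ (Od · K) ⟩
  Od · K ∎
  where
  open ≋-Reasoning
  F-even : ∀ k → + 2 ∣ₛ + suc k → Supp (+ 2) (+ 0) (F (suc k))
  F-even = Supp-F
  K-even : Supp (+ 2) (+ 0) K
  K-even = Supp-· (Supp-· (Supp-^ (F-even 5 (from-yes (+ 2 ∣ₛ? + 6))) 5)
    (Supp-^ (F-even 3 (from-yes (+ 2 ∣ₛ? + 4))) 2)) (Supp-^ (F-even 11 (from-yes (+ 2 ∣ₛ? + 12))) 2)

φ-q-mod2 : ∀ k → φ (q ^ suc k) ≈[ + 2 ] const (+ 1)
φ-q-mod2 k = Gauss.φ-mod2 (q^₀ k)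

neg-mod2 : ∀ a → -ˢ a ≈[ + 2 ] a
neg-mod2 a = ≈-sym (mod a (solve 1 (λ a → a := :- a :+ con (+ 2) :* a) ≋-refl a))

one-^ : ∀ k → const (+ 1) ^ k ≋ const (+ 1)
one-^ zero    = ≋-refl
one-^ (suc k) = ≋-trans (SR.*-identityˡ _) (one-^ k)

U-mod8 : U ≈[ + 8 ] const (+ 1)
U-mod8 = ≈-trans (≈-drop (+ 8) _) (≈-trans
  (≋⇒≈ (+ 8) (solve 1 (λ a → a :^ 4 := (a :^ 2) :^ 2) ≋-refl a₃))
  (≈-trans (≈-square (+ 2) (≈-square (+ 1) (φ-q-mod2 11)))
    (≋⇒≈ (+ 8) (≋-trans (^-congˡ 2 (one-^ 2)) (one-^ 2)))))

VW-mod2 : V · W ≈[ + 2 ] b₃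
VW-mod2 = begin
  V · W
    ≈⟨ ≋⇒≈ (+ 2) (solve 4 (λ a₁ b₁ a₃ b₃ →
         (a₃ :* b₃ :* (a₃ :^ 2 :+ con (+ 4) :* (b₃ :* b₃))) :* (a₁ :* a₃ :+ con (+ 4) :* (b₁ :* b₃))
         := a₃ :^ 4 :* a₁ :* b₃ :+ con (+ 2) :* (con (+ 2) :* (a₃ :^ 3 :* b₁ :* b₃ :* b₃ :+ a₃ :^ 2 :* a₁ :* b₃ :^ 3 :+ con (+ 4) :* (a₃ :* b₁ :* b₃ :^ 4))))
         ≋-refl a₁ b₁ a₃ b₃) ⟩
  a₃ ^ 4 · a₁ · b₃ +ˢ const (+ 2) · _
    ≈⟨ ≈-drop (+ 2) _ ⟩
  a₃ ^ 4 · a₁ · b₃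
    ≈⟨ ≈-· (≈-· (≈-^ 4 (φ-q-mod2 11)) (φ-q-mod2 3)) ≈-refl ⟩
  const (+ 1) ^ 4 · const (+ 1) · b₃
    ≈⟨ ≋⇒≈ (+ 2) (solve 1 (λ b → con (+ 1) :^ 4 :* con (+ 1) :* b := b) ≋-refl b₃) ⟩
  b₃ ∎
  where open SetoidReasoning (≈-setoid (+ 2))

-- The outer factors 2 and 8 reduce this to U ≡ 1 mod 8 and V W ≡ b₃ mod 2.
Od-mod16 : Od ≈[ + 16 ] const (+ 2) · L +ˢ const (+ 8) · b₃
Od-mod16 = ≈-+
  (≈-scale (+ 2) (≈-trans (≈-· U-mod8 ≈-refl) (≋⇒≈ (+ 8) (SR.*-identityˡ L))))
  (≈-trans (≋⇒≈ (+ 16) (solve 1 (λ v → :- (con (+ 8) :* v) := con (+ 8) :* (:- v)) ≋-refl (V · W)))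
    (≈-scale (+ 8) (≈-trans (neg-mod2 (V · W)) VW-mod2)))

CP3-odd-even : CP3-odd ≈[ + 2 ] const (+ 0)
CP3-odd-even = cancel≈ (unit-^ 7 (F-inverse 2)) (≈-trans (≋⇒≈ (+ 2) CP3-odd-theta)
  (≈-trans (≈-· (≈-trans (≈-weaken (+ 8) Od-mod16) (≈-trans
      (≋⇒≈ (+ 2) (solve 2 (λ l b → con (+ 2) :* l :+ con (+ 8) :* b := con (+ 0) :+ con (+ 2) :* (l :+ con (+ 4) :* b)) ≋-refl L b₃))
      (≈-drop (+ 2) _))) (≈-refl {a = K}))
    (≋⇒≈ (+ 2) (solve 2 (λ k g → con (+ 0) :* k := con (+ 0) :* g) ≋-refl K (F 2 ^ 7)))))

-- CP3-odd is twice a series, so a congruence modulo 8 is enough for the factor F₂⁸.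
CP3-odd-F2⁸ : CP3-odd · F 2 ^ 8 ≈[ + 16 ] CP3-odd · F 4 ^ 4
CP3-odd-F2⁸ = ≈-trans (≋⇒≈ (+ 16) (halve (F 2 ^ 8)))
  (≈-trans (≈-scale (+ 2) (≈-· (≈-refl {a = h}) (F-eighth-mod8 1))) (≋⇒≈ (+ 16) (≋-sym (halve (F 4 ^ 4)))))
  where
  h = quot CP3-odd-even
  halve : ∀ a → CP3-odd · a ≋ const (+ 2) · (h · a)
  halve a = ≋-trans (·-cong (eq CP3-odd-even) ≋-refl)
    (solve 2 (λ h a → (con (+ 0) :+ con (+ 2) :* h) :* a := con (+ 2) :* (h :* a)) ≋-refl h a)

-- Reduction of the odd part modulo 16

Y₂ Y₈ Z : Series
Y₂ = inv (F 2)
Y₈ = inv (F 8)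
Z  = (F 6 ^ 3 · Y₂) ^ 3

L-product : L · F 2 · F 6 ≋ q ^ 1 · F 4 ^ 2 · F 12 ^ 2
L-product = ≋-trans (·-cong (·-cong L-ψψ ≋-refl) ≋-refl) (≋-trans
  (solve 5 (λ q a b f g → q :* a :* b :* f :* g := q :* (a :* f) :* (b :* g)) ≋-refl (q ^ 1) (ψ (q ^ 2)) (ψ (q ^ 6)) (F 2) (F 6))
  (·-cong (·-cong ≋-refl (ψ-F 1)) (ψ-F 5)))

-- Modulo 2 the left side is f₆¹⁰ f₂⁵. Inserting (f₂/f₂)³ makes it (f₆⁹/f₂³) f₂⁸ f₆, and f₂⁸ ≡ f₄⁴.
Z-term : F 6 ^ 6 · F 4 ^ 2 · F 12 ^ 2 · F 2 ≈[ + 2 ] Z · (F 4 ^ 4 · F 6)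
Z-term = begin
  F 6 ^ 6 · F 4 ^ 2 · F 12 ^ 2 · F 2
    ≈⟨ ≈-· (≈-· (≈-· ≈-refl (≈-^ 2 (≈-sym (F-square-mod2 1)))) (≈-^ 2 (≈-sym (F-square-mod2 5)))) ≈-refl ⟩
  F 6 ^ 6 · (F 2 ^ 2) ^ 2 · (F 6 ^ 2) ^ 2 · F 2
    ≈⟨ ≋⇒≈ (+ 2) (≋-trans
         (solve 2 (λ f g → g :^ 6 :* (f :^ 2) :^ 2 :* (g :^ 2) :^ 2 :* f := g :^ 10 :* f :^ 5 :* con (+ 1) :^ 3) ≋-refl (F 2) (F 6))
         (·-cong ≋-refl (^-congˡ 3 (≋-sym (F-inverse 2))))) ⟩
  F 6 ^ 10 · F 2 ^ 5 · (F 2 · Y₂) ^ 3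
    ≈⟨ ≋⇒≈ (+ 2) (solve 3 (λ f g y → g :^ 10 :* f :^ 5 :* (f :* y) :^ 3 := (g :^ 3 :* y) :^ 3 :* ((f :^ 2) :^ 4 :* g)) ≋-refl (F 2) (F 6) Y₂) ⟩
  Z · ((F 2 ^ 2) ^ 4 · F 6)
    ≈⟨ ≈-· (≈-refl {a = Z}) (≈-· (≈-^ 4 (F-square-mod2 1)) ≈-refl) ⟩
  Z · (F 4 ^ 4 · F 6) ∎
  where open SetoidReasoning (≈-setoid (+ 2))

-- The theta form is multiplied by f₂ f₆ because L f₂ f₆ is a product; at the same time f₂⁷ becomes
-- f₂⁸, which may be replaced by f₄⁴. Both terms then contain the unit f₄⁴ f₆.
CP3-odd-mod16 : CP3-odd ≈[ + 16 ] const (+ 2) · (q ^ 1 · F 12 ^ 4 · F 6 ^ 4) +ˢ const (+ 8) · (b₃ · Z)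
CP3-odd-mod16 = cancel≈ unit (begin
  CP3-odd · (F 4 ^ 4 · F 6)
    ≈⟨ ≋⇒≈ (+ 16) (SR.sym (SR.*-assoc _ _ _)) ⟩
  CP3-odd · F 4 ^ 4 · F 6
    ≈⟨ ≈-· (≈-sym CP3-odd-F2⁸) ≈-refl ⟩
  CP3-odd · F 2 ^ 8 · F 6
    ≈⟨ ≋⇒≈ (+ 16) (≋-trans (solve 3 (λ c f g → c :* f :^ 8 :* g := (c :* f :^ 7) :* (f :* g)) ≋-refl CP3-odd (F 2) (F 6))
         (·-cong CP3-odd-theta ≋-refl)) ⟩
  Od · K · (F 2 · F 6)
    ≈⟨ ≈-· (≈-· Od-mod16 (≈-refl {a = K})) (≈-refl {a = F 2 · F 6}) ⟩
  (const (+ 2) · L +ˢ const (+ 8) · b₃) · K · (F 2 · F 6)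
    ≈⟨ ≋⇒≈ (+ 16) (≋-trans
         (solve 6 (λ l b f₂ f₄ f₆ f₁₂ → (con (+ 2) :* l :+ con (+ 8) :* b) :* (f₆ :^ 5 :* f₄ :^ 2 :* f₁₂ :^ 2) :* (f₂ :* f₆)
            := con (+ 2) :* ((l :* f₂ :* f₆) :* (f₆ :^ 5 :* f₄ :^ 2 :* f₁₂ :^ 2)) :+ con (+ 8) :* (b :* (f₆ :^ 6 :* f₄ :^ 2 :* f₁₂ :^ 2 :* f₂)))
            ≋-refl L b₃ (F 2) (F 4) (F 6) (F 12))
         (+-cong (·-cong ≋-refl (·-cong L-product ≋-refl)) ≋-refl)) ⟩
  const (+ 2) · ((q ^ 1 · F 4 ^ 2 · F 12 ^ 2) · K) +ˢ const (+ 8) · (b₃ · (F 6 ^ 6 · F 4 ^ 2 · F 12 ^ 2 · F 2))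
    ≈⟨ ≈-+ ≈-refl (≈-scale (+ 8) (≈-· (≈-refl {a = b₃}) Z-term)) ⟩
  const (+ 2) · ((q ^ 1 · F 4 ^ 2 · F 12 ^ 2) · K) +ˢ const (+ 8) · (b₃ · (Z · (F 4 ^ 4 · F 6)))
    ≈⟨ ≋⇒≈ (+ 16) (solve 6 (λ x b z f₄ f₆ f₁₂ →
         con (+ 2) :* ((x :* f₄ :^ 2 :* f₁₂ :^ 2) :* (f₆ :^ 5 :* f₄ :^ 2 :* f₁₂ :^ 2)) :+ con (+ 8) :* (b :* (z :* (f₄ :^ 4 :* f₆)))
         := (con (+ 2) :* (x :* f₁₂ :^ 4 :* f₆ :^ 4) :+ con (+ 8) :* (b :* z)) :* (f₄ :^ 4 :* f₆))
         ≋-refl (q ^ 1) b₃ Z (F 4) (F 6) (F 12)) ⟩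
  (const (+ 2) · (q ^ 1 · F 12 ^ 4 · F 6 ^ 4) +ˢ const (+ 8) · (b₃ · Z)) · (F 4 ^ 4 · F 6) ∎)
  where
  open SetoidReasoning (≈-setoid (+ 16))
  unit : (F 4 ^ 4 · F 6) · (inv (F 4) ^ 4 · inv (F 6)) ≋ const (+ 1)
  unit = ≋-trans (solve 4 (λ a b u v → (a :* b) :* (u :* v) := (a :* u) :* (b :* v)) ≋-refl (F 4 ^ 4) (F 6) (inv (F 4) ^ 4) (inv (F 6)))
    (≋-trans (·-cong (unit-^ 4 (F-inverse 4)) (F-inverse 6)) (SR.*-identityˡ (const (+ 1))))

-- The lattice identity modulo 2, where φ ≡ 1 and ψ(q^k) ≡ f_k³, divided by q.
F2³F6³-mod2 : F 2 ^ 3 · F 6 ^ 3 ≈[ + 2 ] F 8 ^ 3 +ˢ q ^ 2 · F 24 ^ 3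
F2³F6³-mod2 = q-cancel≈ (begin
  q · (F 2 ^ 3 · F 6 ^ 3)
    ≈⟨ ≈-· ≈-refl (≈-sym (≈-· (ψ-mod2 1) (ψ-mod2 5))) ⟩
  q · (ψ (q ^ 2) · ψ (q ^ 6))
    ≈⟨ ≋⇒≈ (+ 2) (≋-trans (solve 3 (λ q a b → q :* (a :* b) := q :^ 1 :* a :* b) ≋-refl q (ψ (q ^ 2)) (ψ (q ^ 6))) (≋-sym L-ψψ)) ⟩
  a₁ · b₃ +ˢ b₁ · a₃
    ≈⟨ ≈-+ (≈-· (φ-q-mod2 3) (≈-· ≈-refl (ψ-mod2 23))) (≈-· (≈-· ≈-refl (ψ-mod2 7)) (φ-q-mod2 11)) ⟩
  const (+ 1) · (q ^ 3 · F 24 ^ 3) +ˢ q ^ 1 · F 8 ^ 3 · const (+ 1)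
    ≈⟨ ≋⇒≈ (+ 2) (solve 3 (λ q a b → con (+ 1) :* (q :^ 3 :* a) :+ q :^ 1 :* b :* con (+ 1) := q :* (b :+ q :^ 2 :* a)) ≋-refl q (F 24 ^ 3) (F 8 ^ 3)) ⟩
  q · (F 8 ^ 3 +ˢ q ^ 2 · F 24 ^ 3) ∎)
  where open SetoidReasoning (≈-setoid (+ 2))

Y₂⁴-mod2 : Y₂ ^ 4 ≈[ + 2 ] Y₈
Y₂⁴-mod2 = cancel≈ {v = Y₈} (F-inverse 8) (begin
  Y₂ ^ 4 · F 8          ≈⟨ ≈-· ≈-refl (≈-sym (F-fourth-mod2 1)) ⟩
  Y₂ ^ 4 · F 2 ^ 4      ≈⟨ ≋⇒≈ (+ 2) (≋-trans (SR.*-comm _ _) (≋-trans (unit-^ 4 (F-inverse 2))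
                              (≋-trans (≋-sym (F-inverse 8)) (SR.*-comm _ _)))) ⟩
  Y₈ · F 8 ∎)
  where open SetoidReasoning (≈-setoid (+ 2))

-- Writing f₆³/f₂ as f₂³ f₆³/f₂⁴ gives (f₈³ + q² f₂₄³)/f₈ modulo 2. In its cube the binomial
-- coefficients 3 are odd, so all four terms stay.
Z-mod2 : Z ≈[ + 2 ] (F 8 ^ 6 +ˢ q ^ 2 · (F 8 ^ 3 · F 24 ^ 3)) +ˢ (q ^ 4 · F 24 ^ 6 +ˢ q ^ 6 · (F 24 ^ 9 · Y₈ ^ 3))
Z-mod2 = begin
  (F 6 ^ 3 · Y₂) ^ 3
    ≈⟨ ≋⇒≈ (+ 2) (^-congˡ 3 (≋-trans (solve 2 (λ g y → g :* y := g :* y :* con (+ 1) :^ 3) ≋-refl (F 6 ^ 3) Y₂)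
         (≋-trans (·-cong ≋-refl (^-congˡ 3 (≋-sym (F-inverse 2))))
           (solve 3 (λ f g y → g :* y :* (f :* y) :^ 3 := (f :^ 3 :* g) :* y :^ 4) ≋-refl (F 2) (F 6 ^ 3) Y₂)))) ⟩
  ((F 2 ^ 3 · F 6 ^ 3) · Y₂ ^ 4) ^ 3
    ≈⟨ ≈-^ 3 (≈-· F2³F6³-mod2 Y₂⁴-mod2) ⟩
  ((F 8 ^ 3 +ˢ q ^ 2 · F 24 ^ 3) · Y₈) ^ 3
    ≈⟨ ≋⇒≈ (+ 2) (solve 4 (λ f g y q → ((f :^ 3 :+ q :^ 2 :* g :^ 3) :* y) :^ 3
         := ((f :^ 6 :* (f :* y) :^ 3 :+ q :^ 2 :* (f :^ 3 :* (f :* y) :^ 3 :* g :^ 3))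
            :+ (q :^ 4 :* ((f :* y) :^ 3 :* g :^ 6) :+ q :^ 6 :* (g :^ 9 :* y :^ 3)))
            :+ con (+ 2) :* (f :^ 6 :* q :^ 2 :* g :^ 3 :* y :^ 3 :+ f :^ 3 :* q :^ 4 :* g :^ 6 :* y :^ 3))
         ≋-refl (F 8) (F 24) Y₈ q) ⟩
  ((F 8 ^ 6 · (F 8 · Y₈) ^ 3 +ˢ q ^ 2 · (F 8 ^ 3 · (F 8 · Y₈) ^ 3 · F 24 ^ 3))
    +ˢ (q ^ 4 · ((F 8 · Y₈) ^ 3 · F 24 ^ 6) +ˢ q ^ 6 · (F 24 ^ 9 · Y₈ ^ 3))) +ˢ const (+ 2) · _
    ≈⟨ ≈-drop (+ 2) _ ⟩
  (F 8 ^ 6 · (F 8 · Y₈) ^ 3 +ˢ q ^ 2 · (F 8 ^ 3 · (F 8 · Y₈) ^ 3 · F 24 ^ 3))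
    +ˢ (q ^ 4 · ((F 8 · Y₈) ^ 3 · F 24 ^ 6) +ˢ q ^ 6 · (F 24 ^ 9 · Y₈ ^ 3))
    ≈⟨ ≋⇒≈ (+ 2) (+-cong (+-cong (·-cong ≋-refl FY) (·-cong ≋-refl (·-cong (·-cong ≋-refl FY) ≋-refl)))
         (+-cong (·-cong ≋-refl (·-cong FY ≋-refl)) ≋-refl)) ⟩
  (F 8 ^ 6 · const (+ 1) +ˢ q ^ 2 · (F 8 ^ 3 · const (+ 1) · F 24 ^ 3))
    +ˢ (q ^ 4 · (const (+ 1) · F 24 ^ 6) +ˢ q ^ 6 · (F 24 ^ 9 · Y₈ ^ 3))
    ≈⟨ ≋⇒≈ (+ 2) (+-cong (+-cong (SR.*-identityʳ _) (·-cong ≋-refl (·-cong (SR.*-identityʳ _) ≋-refl)))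
         (+-cong (·-cong ≋-refl (SR.*-identityˡ _)) ≋-refl)) ⟩
  (F 8 ^ 6 +ˢ q ^ 2 · (F 8 ^ 3 · F 24 ^ 3)) +ˢ (q ^ 4 · F 24 ^ 6 +ˢ q ^ 6 · (F 24 ^ 9 · Y₈ ^ 3)) ∎
  where
  open SetoidReasoning (≈-setoid (+ 2))
  FY : (F 8 · Y₈) ^ 3 ≋ const (+ 1)
  FY = ≋-trans (^-congˡ 3 (F-inverse 8)) (one-^ 3)

-- `M₁` comes from f₆² = φ(-q⁶) f₁₂ = (a₆ - 2b₆) f₁₂, squared and stripped of its cross term. The
-- others are three of the four terms of f₂₄³ Z modulo 2; the missing one is q⁴ f₂₄⁹.
M₁ M₃ M₅ M₉ : Series
M₁ = F 12 ^ 6 · (a₆ ^ 2 +ˢ const (+ 4) · (b₆ · b₆))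
M₃ = F 24 ^ 3 · F 8 ^ 6
M₅ = F 24 ^ 6 · F 8 ^ 3
M₉ = F 24 ^ 12 · Y₈ ^ 3

-- The two halves of the class 7 mod 24, one from each summand of CP3-odd-mod16, cancel modulo 16.
CP3-odd-classes : CP3-odd ≈[ + 16 ] const (+ 2) · (q ^ 1 · M₁) +ˢ
                    const (+ 8) · (q ^ 3 · M₃ +ˢ q ^ 5 · M₅ +ˢ q ^ 9 · M₉)
CP3-odd-classes = begin
  CP3-odd
    ≈⟨ CP3-odd-mod16 ⟩
  const (+ 2) · (q ^ 1 · F 12 ^ 4 · F 6 ^ 4) +ˢ const (+ 8) · (b₃ · Z)
    ≈⟨ ≈-+ (≋⇒≈ (+ 16) first) (≈-scale (+ 8) (≈-· (≈-· (≈-refl {a = q ^ 3}) (ψ-mod2 23)) Z-mod2)) ⟩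
  (const (+ 2) · (q ^ 1 · M₁) +ˢ const (+ 8) · (-ˢ (q ^ 1 · F 12 ^ 6 · a₆ · b₆)))
    +ˢ const (+ 8) · (q ^ 3 · F 24 ^ 3 · ((F 8 ^ 6 +ˢ q ^ 2 · (F 8 ^ 3 · F 24 ^ 3)) +ˢ (q ^ 4 · F 24 ^ 6 +ˢ q ^ 6 · (F 24 ^ 9 · Y₈ ^ 3))))
    ≈⟨ ≈-+ (≈-+ ≈-refl (≈-scale (+ 8) cross)) ≈-refl ⟩
  (const (+ 2) · (q ^ 1 · M₁) +ˢ const (+ 8) · (q ^ 7 · F 24 ^ 9))
    +ˢ const (+ 8) · (q ^ 3 · F 24 ^ 3 · ((F 8 ^ 6 +ˢ q ^ 2 · (F 8 ^ 3 · F 24 ^ 3)) +ˢ (q ^ 4 · F 24 ^ 6 +ˢ q ^ 6 · (F 24 ^ 9 · Y₈ ^ 3))))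
    ≈⟨ ≋⇒≈ (+ 16) (solve 5 (λ m q f g y →
         (con (+ 2) :* (q :^ 1 :* m) :+ con (+ 8) :* (q :^ 7 :* g :^ 9))
           :+ con (+ 8) :* (q :^ 3 :* g :^ 3 :* ((f :^ 6 :+ q :^ 2 :* (f :^ 3 :* g :^ 3)) :+ (q :^ 4 :* g :^ 6 :+ q :^ 6 :* (g :^ 9 :* y :^ 3))))
         := (con (+ 2) :* (q :^ 1 :* m) :+ con (+ 8) :* (q :^ 3 :* (g :^ 3 :* f :^ 6) :+ q :^ 5 :* (g :^ 6 :* f :^ 3) :+ q :^ 9 :* (g :^ 12 :* y :^ 3)))
            :+ con (+ 16) :* (q :^ 7 :* g :^ 9)) ≋-refl M₁ q (F 8) (F 24) Y₈) ⟩
  (const (+ 2) · (q ^ 1 · M₁) +ˢ const (+ 8) · (q ^ 3 · M₃ +ˢ q ^ 5 · M₅ +ˢ q ^ 9 · M₉)) +ˢ const (+ 16) · _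
    ≈⟨ ≈-drop (+ 16) _ ⟩
  const (+ 2) · (q ^ 1 · M₁) +ˢ const (+ 8) · (q ^ 3 · M₃ +ˢ q ^ 5 · M₅ +ˢ q ^ 9 · M₉) ∎
  where
  open SetoidReasoning (≈-setoid (+ 16))
  first : const (+ 2) · (q ^ 1 · F 12 ^ 4 · F 6 ^ 4) ≋
          const (+ 2) · (q ^ 1 · M₁) +ˢ const (+ 8) · (-ˢ (q ^ 1 · F 12 ^ 6 · a₆ · b₆))
  first = ≋-trans (·-cong ≋-refl (·-cong ≋-refl (≋-trans (solve 1 (λ f → f :^ 4 := (f :^ 2) :^ 2) ≋-refl (F 6))
      (^-congˡ 2 (≋-trans (≋-sym (φ⁻-F 5)) (·-cong (φ⁻-split-q 5) ≋-refl))))))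
    (solve 4 (λ x f a b → con (+ 2) :* (x :* f :^ 4 :* ((a :+ :- (con (+ 2) :* b)) :* f) :^ 2)
      := con (+ 2) :* (x :* (f :^ 6 :* (a :^ 2 :+ con (+ 4) :* (b :* b)))) :+ con (+ 8) :* (:- (x :* f :^ 6 :* a :* b)))
      ≋-refl (q ^ 1) (F 12) a₆ b₆)
  -- Modulo 2: f₁₂⁶ ≡ f₂₄³, a₆ ≡ 1, and ψ(q⁴⁸) ≡ f₄₈³ ≡ f₂₄⁶.
  cross : -ˢ (q ^ 1 · F 12 ^ 6 · a₆ · b₆) ≈[ + 2 ] q ^ 7 · F 24 ^ 9
  cross = ≈-trans (neg-mod2 _) (≈-trans
    (≈-· (≈-· (≈-· (≈-refl {a = q ^ 1}) (≈-trans (≋⇒≈ (+ 2) (solve 1 (λ f → f :^ 6 := (f :^ 2) :^ 3) ≋-refl (F 12))) (≈-^ 3 (F-square-mod2 11))))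
        (φ-q-mod2 23)) (≈-· (≈-refl {a = q ^ 6}) (≈-trans (ψ-mod2 47) (≈-^ 3 (≈-sym (F-square-mod2 23))))))
    (≋⇒≈ (+ 2) (solve 2 (λ q g → q :^ 1 :* g :^ 3 :* con (+ 1) :* (q :^ 6 :* (g :^ 2) :^ 3) := q :^ 7 :* g :^ 9) ≋-refl q (F 24))))

M₁-Supp : Supp (+ 12) (+ 0) M₁
M₁-Supp = Supp-· (Supp-^ (Supp-F 11 (from-yes (+ 12 ∣ₛ? + 12))) 6)
  (Supp-+ (Supp-^ (Supp-φ 23 (from-yes (+ 12 ∣ₛ? + 24))) 2) (Supp-· (Supp-const (+ 4)) (Supp-· b₆-Supp b₆-Supp′)))
  where
  b₆-Supp : Supp (+ 12) (+ 6) b₆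
  b₆-Supp = Supp-· (Supp-q^ (+ 12) 6) (Supp-ψ 47 (from-yes (+ 12 ∣ₛ? + 48)))
  -- The representative -6 of the class 6 mod 12 makes the residue of b₆² come out as exactly 0.
  b₆-Supp′ : Supp (+ 12) (-[1+ 5 ]) b₆
  b₆-Supp′ = Supp-shift -[1+ 5 ] (from-yes (+ 12 ∣ₛ? + 12)) b₆-Supp

-- Modulo 2 the support shrinks from multiples of 12 to multiples of 24, which separates the class
-- 13 from the class 1.
M₁-mod2 : M₁ ≈[ + 2 ] F 24 ^ 3
M₁-mod2 = ≈-trans (≈-·
    (≈-trans (≋⇒≈ (+ 2) (solve 1 (λ f → f :^ 6 := (f :^ 2) :^ 3) ≋-refl (F 12))) (≈-^ 3 (F-square-mod2 11)))
    (≈-trans (≋⇒≈ (+ 2) (solve 2 (λ a b → a :+ con (+ 4) :* b := a :+ con (+ 2) :* (con (+ 2) :* b)) ≋-refl (a₆ ^ 2) (b₆ · b₆)))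
      (≈-trans (≈-drop (+ 2) _) (≈-^ 2 (φ-q-mod2 23)))))
  (≋⇒≈ (+ 2) (solve 1 (λ g → g :* con (+ 1) :^ 2 := g) ≋-refl (F 24 ^ 3)))

F₈-Supp : Supp (+ 8) (+ 0) (F 8)
F₈-Supp = Supp-F 7 (from-yes (+ 8 ∣ₛ? + 8))

F₂₄-Supp : Supp (+ 8) (+ 0) (F 24)
F₂₄-Supp = Supp-F 23 (from-yes (+ 8 ∣ₛ? + 24))

M₃-Supp : Supp (+ 8) (+ 0) M₃
M₃-Supp = Supp-· (Supp-^ F₂₄-Supp 3) (Supp-^ F₈-Supp 6)

M₅-Supp : Supp (+ 8) (+ 0) M₅
M₅-Supp = Supp-· (Supp-^ F₂₄-Supp 6) (Supp-^ F₈-Supp 3)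

M₉-Supp : Supp (+ 8) (+ 0) M₉
M₉-Supp = Supp-· (Supp-^ F₂₄-Supp 12) (Supp-^ (Supp-inverse (F-inverse 8) F₈-Supp) 3)

-- Evaluation on the classes modulo 24

Supp-q^· : ∀ {d a} k → Supp d (+ 0) a → Supp d (+ k) (q ^ k · a)
Supp-q^· {d} {a} k s = subst (λ r → Supp d r (q ^ k · a)) (ℤ.+-identityʳ (+ k)) (Supp-· (Supp-q^ d k) s)

class-shift : ∀ m r s → + (24 ℕ.* m ℕ.+ r) ℤ.- s ≡ + 24 ℤ.* + m ℤ.+ (+ r ℤ.- s)
class-shift m r s = trans (cong (λ i → i ℤ.+ + r ℤ.- s) (ℤ.pos-* 24 m)) (ℤ.+-assoc (+ 24 ℤ.* + m) (+ r) (ℤ.- s))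

vanish-class : ∀ {d s a} m r → Supp d s a → d ∣ₛ + 24 → ¬ (d ∣ₛ + r ℤ.- s) → a (24 ℕ.* m ℕ.+ r) ≡ + 0
vanish-class {d} {s} m r p d∣24 d∤ = vanish p (24 ℕ.* m ℕ.+ r) λ d∣ →
  d∤ (Signed.∣m+n∣m⇒∣n (subst (d ∣ₛ_) (class-shift m r s) d∣) (Signed.∣m⇒∣m*n (+ m) d∣24))

CP3-odd-at : ∀ m r → + 2 ∣ₛ + r ℤ.- + 1 → CP3-odd (24 ℕ.* m ℕ.+ r) ≡ CP3 (24 ℕ.* m ℕ.+ r)
CP3-odd-at m r 2∣ = proj-at (+ 2) (+ 1) CP3 (24 ℕ.* m ℕ.+ r) (subst (+ 2 ∣ₛ_) (sym (class-shift m r (+ 1)))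
  (Signed.∣m∣n⇒∣m+n (Signed.∣m⇒∣m*n (+ m) (from-yes (+ 2 ∣ₛ? + 24))) 2∣))

≈-divides : ∀ {M a b} n → a ≈[ M ] b → b n ≡ + 0 → M ∣ₛ a n
≈-divides {M} {a} {b} n (mod c e) b₀ = divides (c n) (trans (at e n) (trans (+ˢ-at b _ n)
  (trans (cong₂ ℤ._+_ b₀ (const-· M c n)) (trans (ℤ.+-identityˡ _) (ℤ.*-comm M (c n))))))

+-vanish : ∀ {a b} n → a n ≡ + 0 → b n ≡ + 0 → (a +ˢ b) n ≡ + 0
+-vanish {a} {b} n p r = trans (+ˢ-at a b n) (cong₂ ℤ._+_ p r)

const-vanish : ∀ k {a} n → a n ≡ + 0 → (const k · a) n ≡ + 0
const-vanish k {a} n p = trans (const-· k a n) (trans (cong (k ℤ.*_) p) (ℤ.*-zeroʳ k))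

qM₁-vanish : ∀ m r → ¬ (+ 12 ∣ₛ + r ℤ.- + 1) → (const (+ 2) · (q ^ 1 · M₁)) (24 ℕ.* m ℕ.+ r) ≡ + 0
qM₁-vanish m r r∤ = const-vanish (+ 2) (24 ℕ.* m ℕ.+ r) (vanish-class m r (Supp-q^· 1 M₁-Supp) (from-yes (+ 12 ∣ₛ? + 24)) r∤)

16∣CP3[24n+7] : ∀ n → + 16 ∣ₛ CP3 (24 ℕ.* n ℕ.+ 7)
16∣CP3[24n+7] n = subst (+ 16 ∣ₛ_) (CP3-odd-at n 7 (from-yes (+ 2 ∣ₛ? + 6))) (≈-divides N CP3-odd-classes
  (+-vanish N (qM₁-vanish n 7 (from-no (+ 12 ∣ₛ? + 6)))
    (const-vanish (+ 8) N (+-vanish N (+-vanish N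
      (vanish-class n 7 (Supp-q^· 3 M₃-Supp) 8∣24 (from-no (+ 8 ∣ₛ? + 4)))
      (vanish-class n 7 (Supp-q^· 5 M₅-Supp) 8∣24 (from-no (+ 8 ∣ₛ? + 2))))
      (vanish-class n 7 (Supp-q^· 9 M₉-Supp) 8∣24 (from-no (+ 8 ∣ₛ? -[1+ 1 ])))))))
  where
  N = 24 ℕ.* n ℕ.+ 7
  8∣24 = from-yes (+ 8 ∣ₛ? + 24)

CP3-odd-mod8 : CP3-odd ≈[ + 8 ] const (+ 2) · (q ^ 1 · M₁)
CP3-odd-mod8 = ≈-trans (≈-weaken (+ 2) CP3-odd-classes) (≈-drop (+ 8) _)

4∣CP3[24n+13] : ∀ n → + 4 ∣ₛ CP3 (24 ℕ.* n ℕ.+ 13)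
4∣CP3[24n+13] n = subst (+ 4 ∣ₛ_) (CP3-odd-at n 13 (from-yes (+ 2 ∣ₛ? + 12))) (≈-divides N
  (≈-trans (≈-weaken (+ 2) CP3-odd-mod8) (≈-scale (+ 2) (≈-· (≈-refl {a = q ^ 1}) M₁-mod2)))
  (const-vanish (+ 2) N (vanish-class n 13 (Supp-q^· 1 (Supp-^ (Supp-F 23 (from-yes (+ 24 ∣ₛ? + 24))) 3))
    (from-yes (+ 24 ∣ₛ? + 24)) (from-no (+ 24 ∣ₛ? + 12)))))
  where N = 24 ℕ.* n ℕ.+ 13

8∣CP3[24n+19] : ∀ n → + 8 ∣ₛ CP3 (24 ℕ.* n ℕ.+ 19)
8∣CP3[24n+19] n = subst (+ 8 ∣ₛ_) (CP3-odd-at n 19 (from-yes (+ 2 ∣ₛ? + 18)))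
  (≈-divides (24 ℕ.* n ℕ.+ 19) CP3-odd-mod8 (qM₁-vanish n 19 (from-no (+ 12 ∣ₛ? + 18))))

theorem3p6 : (n : ℕ) →
    ((+ 16) ∣ CP3 (24 * n + 7)) × ((+ 4) ∣ CP3 (24 * n + 13)) × ((+ 8) ∣ CP3 (24 * n + 19))
theorem3p6 n = Signed.∣⇒∣ᵤ (16∣CP3[24n+7] n) , Signed.∣⇒∣ᵤ (4∣CP3[24n+13] n) , Signed.∣⇒∣ᵤ (8∣CP3[24n+19] n)
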